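{- Let $n,s,k$ be positive integers with $s\leq n$, and suppose that $\mathcal{F}\subseteq 2^{[n]}$ is $(2,s)$-conditionally intersecting. If $s=2k$, then \[ |\mathcal{F}|\leq \binom{n-1}{k-1}+\sum_{i=k+1}^{n}\binom{n}{i}, \] and if $s < n$ also holds, then equality holds if and only if, up to isomorphism (i.e. up to a permutation of $[n]$), \[ \mathcal{F} = \left\{ F\in \binom{[n]}{k} : 1\in F\right\} \cup \{F\in 2^{[n]} : |F|>k\}. \] If $s=2k-1$, then \[ |\mathcal{F}|\leq \sum_{i=k}^{n}\binom{n}{i}, \] and if $s < n$ also holds, then equality holds if and only if $\mathcal{F} = \{F\in 2^{[n]} : |F|\geq k\}$.
   Context: $[n]=\{1,\ldots,n\}$, $2^{[n]}$ is its power set, and $\binom{[n]}{k}$ is the family of all $k$-element subsets of $[n]$. A family $\mathcal{F} \subseteq 2^{[n]}$ is $(2,s)$-conditionally intersecting if, for each $A,B\in\mathcal{F}$ (not required to be distinct), $A \cap B \neq \emptyset$ whenever $|A \cup B| \leq s$. In particular, such a family does not contain the empty set. -}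

module Defs where

open import Data.Fin.Base using (Fin; zero)
open import Data.Fin.Permutation using (Permutation′; _⟨$⟩ˡ_)
open import Data.Fin.Subset using (Subset; _∩_; _∪_; ∣_∣; Nonempty)
  renaming (_∈_ to _∈ₛ_)
open import Data.List.Base using (List; applyUpTo)
open import Data.List.Membership.Propositional using (_∈_)
open import Data.Nat.Base using (ℕ; suc; _+_; _∸_; _≤_; _<_; NonZero)
open import Data.Nat.ListAction using (sum)
open import Data.Product.Base using (_×_)
open import Data.Sum.Base using (_⊎_)
open import Data.Vec.Base using (lookup; tabulate)
open import Level using (0ℓ)
open import Relation.Binary.PropositionalEquality using (_≡_)
open import Relation.Unary using (Pred)

-- The ground set [n] is Fin n.  A family of subsets of [n] is a list of
-- subsets; wherever its length is meant as a cardinality it is required to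
-- be free of repetitions.

ConditionallyIntersecting₂ : ∀ {n} → ℕ → List (Subset n) → Set
ConditionallyIntersecting₂ s F =
  ∀ {A B} → A ∈ F → B ∈ F → ∣ A ∪ B ∣ ≤ s → Nonempty (A ∩ B)

-- The element written 1 in {1, …, n}.
first : ∀ n .{{_ : NonZero n}} → Fin n
first (suc _) = zero

-- { F : |F| = k and 1 ∈ F } ∪ { F : |F| > k }
StarAndLarger : ∀ n .{{_ : NonZero n}} → ℕ → Pred (Subset n) 0ℓ
StarAndLarger n k A = (∣ A ∣ ≡ k × first n ∈ₛ A) ⊎ k < ∣ A ∣

AtLeast : ∀ n → ℕ → Pred (Subset n) 0ℓ
AtLeast n k A = k ≤ ∣ A ∣

-- The direct image σ(A): x lies in it exactly when σ⁻¹(x) lies in A.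
image : ∀ {n} → Permutation′ n → Subset n → Subset n
image σ A = tabulate λ x → lookup A (σ ⟨$⟩ˡ x)

-- f a + f (a + 1) + ⋯ + f b, which is 0 when a > b.
sumFromTo : ℕ → ℕ → (ℕ → ℕ) → ℕ
sumFromTo a b f = sum (applyUpTo (λ j → f (a + j)) (suc b ∸ a))

syntax sumFromTo a b (λ i → e) = ∑[ i ≔ a to b ] e

{-# OPTIONS --safe #-}
module Submission where

-- Disjoint members A, B of F satisfy |A| + |B| > s.  Hence for i < j with i + j = s the levels F_i and F_j are
-- cross-intersecting, and counting the disjoint pairs between a family of i-sets and all j-sets gives
-- |F_i| + |F_j| ≤ C(n, j), with equality forcing F_i = ∅ when s < n.  Pairing each level below s/2 with its mirror
-- image settles all levels except i = k when s = 2k, where the theorem of Erdős, Ko and Rado applies.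
--
-- The latter goes by induction on the ground set.  Shifting the element 0 towards every other element makes the
-- link of 0 intersecting, so link and deletion are covered by the induction hypothesis; the case n = 2k is again
-- the double counting.  For n > 2k a shift can only turn F into a full star if F is one already, since the
-- Kneser graph of the (k − 1)-subsets of n − 2 points is connected.

open import Defs
import Algebra.Properties.CommutativeMonoid.Sum as CMSum
open import Data.Bool.Base using (Bool; true; false; if_then_else_)
import Data.Bool.Properties as Bool
open import Data.Empty using (⊥; ⊥-elim)
open import Data.Fin.Base using (Fin; zero; suc)
open import Data.Fin.Permutation using (Permutation′; _⟨$⟩ˡ_; flip; inverseʳ; transpose)
open import Data.Fin.Properties using (any?) renaming (_≟_ to _≟ᶠ_)
open import Data.Fin.Subset using (Subset; ∣_∣; inside; outside; _∩_; _∪_; ∁; ⁅_⁆)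
  renaming (_∈_ to _∈ₛ_; _∉_ to _∉ₛ_; _⊆_ to _⊆ₛ_; ⊥ to ∅)
open import Data.Fin.Subset.Properties
  using (∣p∣≤n; nonempty?; x∈p∩q⁺; x∈p∩q⁻; x∈p∪q⁺; _∈?_; ⊆-antisym; p⊂q⇒∣p∣<∣q∣; x∈∁p⇒x∉p; x∉p⇒x∈∁p;
         ∣⊥∣≡0; ∉⊥; anySubset?; ∣⁅x⁆∣≡1; x∈⁅x⁆; Empty-unique; drop-there)
open import Data.List.Base using (List; []; _∷_; length; map; applyUpTo)
import Data.List.Membership.DecPropositional as DecMembership
open import Data.List.Membership.Propositional using (_∈_)
open import Data.List.Membership.Propositional.Properties using (∈-map⁺; ∈-map⁻)
open import Data.List.Properties using (length-map)
import Data.List.Relation.Unary.All as All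
open import Data.List.Relation.Unary.AllPairs using ([]; _∷_)
open import Data.List.Relation.Unary.Any using (here; there)
open import Data.List.Relation.Unary.Unique.Propositional using (Unique)
open import Data.List.Relation.Unary.Unique.Propositional.Properties using (map⁺)
open import Data.Nat.Base
open import Data.Nat.Combinatorics using (_C_; nCk+nC[k+1]≡[n+1]C[k+1]; k>n⇒nCk≡0; nCk≡nC[n∸k])
open import Data.Nat.ListAction using (sum)
open import Data.Nat.Properties
open import Data.Nat.Tactic.RingSolver using (solve-∀)
open import Data.Product.Base using (_×_; _,_; proj₁; proj₂; ∃)
open import Data.Sum.Base using (_⊎_; inj₁; inj₂; [_,_]′)
open import Data.Vec.Base using ([]; _∷_; here; there; _[_]≔_; lookup; tabulate)
import Data.Vec.Properties as Vec
open import Function.Base using (_∘_; id; case_of_)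
open import Function.Bundles using (_⇔_; mk⇔)
open import Level using (0ℓ)
open import Relation.Binary.PropositionalEquality
open import Relation.Nullary using (Dec; does; yes; no; ¬_; contradiction)
open import Relation.Nullary.Decidable using (_×-dec_; _⊎-dec_; ¬?; map′)
open import Relation.Unary using (Pred; Decidable; _≐_)

private
  variable
    m n k : ℕ
    P : Pred (Subset n) 0ℓ

-- Sums over all subsets

Σₛ : (Subset n → ℕ) → ℕ
Σₛ {zero}  f = f []
Σₛ {suc n} f = Σₛ (f ∘ (inside ∷_)) + Σₛ (f ∘ (outside ∷_))

Σₛ-cong : ∀ {f g : Subset n → ℕ} → (∀ A → f A ≡ g A) → Σₛ f ≡ Σₛ g
Σₛ-cong {zero}  f≗g = f≗g []
Σₛ-cong {suc n} f≗g = cong₂ _+_ (Σₛ-cong (λ A → f≗g (inside ∷ A))) (Σₛ-cong (λ A → f≗g (outside ∷ A)))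

Σₛ-mono-≤ : ∀ {f g : Subset n → ℕ} → (∀ A → f A ≤ g A) → Σₛ f ≤ Σₛ g
Σₛ-mono-≤ {zero}  f≤g = f≤g []
Σₛ-mono-≤ {suc n} f≤g = +-mono-≤ (Σₛ-mono-≤ (λ A → f≤g (inside ∷ A))) (Σₛ-mono-≤ (λ A → f≤g (outside ∷ A)))

Σₛ-mono-< : ∀ {f g : Subset n → ℕ} → (∀ A → f A ≤ g A) → ∀ B → f B < g B → Σₛ f < Σₛ g
Σₛ-mono-< f≤g []            fB<gB = fB<gB
Σₛ-mono-< f≤g (inside  ∷ B) fB<gB = +-mono-<-≤ (Σₛ-mono-< (λ A → f≤g (inside ∷ A)) B fB<gB) (Σₛ-mono-≤ (λ A → f≤g (outside ∷ A)))
Σₛ-mono-< f≤g (outside ∷ B) fB<gB = +-mono-≤-< (Σₛ-mono-≤ (λ A → f≤g (inside ∷ A))) (Σₛ-mono-< (λ A → f≤g (outside ∷ A)) B fB<gB)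

Σₛ-zero : ∀ {f : Subset n → ℕ} → (∀ A → f A ≡ 0) → Σₛ f ≡ 0
Σₛ-zero {zero}  f≡0 = f≡0 []
Σₛ-zero {suc n} f≡0 = cong₂ _+_ (Σₛ-zero (λ A → f≡0 (inside ∷ A))) (Σₛ-zero (λ A → f≡0 (outside ∷ A)))

interchange : ∀ a b c d → (a + b) + (c + d) ≡ (a + c) + (b + d)
interchange = solve-∀

Σₛ-+ : ∀ (f g : Subset n → ℕ) → Σₛ (λ A → f A + g A) ≡ Σₛ f + Σₛ g
Σₛ-+ {zero}  f g = refl
Σₛ-+ {suc n} f g = trans
  (cong₂ _+_ (Σₛ-+ (f ∘ (inside ∷_)) (g ∘ (inside ∷_))) (Σₛ-+ (f ∘ (outside ∷_)) (g ∘ (outside ∷_))))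
  (interchange (Σₛ (f ∘ (inside ∷_))) _ _ _)

Σₛ-*ʳ : ∀ (f : Subset n → ℕ) c → Σₛ (λ A → f A * c) ≡ Σₛ f * c
Σₛ-*ʳ {zero}  f c = refl
Σₛ-*ʳ {suc n} f c = trans
  (cong₂ _+_ (Σₛ-*ʳ (f ∘ (inside ∷_)) c) (Σₛ-*ʳ (f ∘ (outside ∷_)) c))
  (sym (*-distribʳ-+ c (Σₛ (f ∘ (inside ∷_))) _))

Σₛ-*ˡ : ∀ c (f : Subset n → ℕ) → Σₛ (λ A → c * f A) ≡ c * Σₛ f
Σₛ-*ˡ c f = trans (Σₛ-cong λ A → *-comm c (f A)) (trans (Σₛ-*ʳ f c) (*-comm _ c))

Σₛ-swap : ∀ (f : Subset m → Subset n → ℕ) →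
          Σₛ (λ A → Σₛ (λ B → f A B)) ≡ Σₛ (λ B → Σₛ (λ A → f A B))
Σₛ-swap {zero}  f = refl
Σₛ-swap {suc m} f = trans
  (cong₂ _+_ (Σₛ-swap (f ∘ (inside ∷_))) (Σₛ-swap (f ∘ (outside ∷_))))
  (sym (Σₛ-+ (λ B → Σₛ (λ A → f (inside ∷ A) B)) _))

-- Indicators and counting

𝟙 : ∀ {p} {X : Set p} → Dec X → ℕ
𝟙 X? = if does X? then 1 else 0

𝟙-mono : ∀ {X Y : Set} (X? : Dec X) (Y? : Dec Y) → (X → Y) → 𝟙 X? ≤ 𝟙 Y?
𝟙-mono (no _)  Y?      X⇒Y = z≤n
𝟙-mono (yes x) (yes _) X⇒Y = ≤-refl
𝟙-mono (yes x) (no ¬y) X⇒Y = contradiction (X⇒Y x) ¬y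

𝟙-cong : ∀ {X Y : Set} (X? : Dec X) (Y? : Dec Y) → (X → Y) → (Y → X) → 𝟙 X? ≡ 𝟙 Y?
𝟙-cong X? Y? X⇒Y Y⇒X = ≤-antisym (𝟙-mono X? Y? X⇒Y) (𝟙-mono Y? X? Y⇒X)

𝟙-yes : ∀ {X : Set} (X? : Dec X) → X → 𝟙 X? ≡ 1
𝟙-yes (yes _) x = refl
𝟙-yes (no ¬x) x = contradiction x ¬x

𝟙-no : ∀ {X : Set} (X? : Dec X) → ¬ X → 𝟙 X? ≡ 0
𝟙-no (no _)  ¬x = refl
𝟙-no (yes x) ¬x = contradiction x ¬x

count : Decidable {A = Subset n} P → ℕ
count P? = Σₛ (λ A → 𝟙 (P? A))

module _ {P Q : Pred (Subset n) 0ℓ} (P? : Decidable P) (Q? : Decidable Q) where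

  count-mono : (∀ A → P A → Q A) → count P? ≤ count Q?
  count-mono P⇒Q = Σₛ-mono-≤ λ A → 𝟙-mono (P? A) (Q? A) (P⇒Q A)

  count-cong : (∀ A → P A → Q A) → (∀ A → Q A → P A) → count P? ≡ count Q?
  count-cong P⇒Q Q⇒P = Σₛ-cong λ A → 𝟙-cong (P? A) (Q? A) (P⇒Q A) (Q⇒P A)

  count-mono-< : (∀ A → P A → Q A) → ∀ B → ¬ P B → Q B → count P? < count Q?
  count-mono-< P⇒Q B ¬PB QB = Σₛ-mono-< (λ A → 𝟙-mono (P? A) (Q? A) (P⇒Q A)) B
    (≤-reflexive (trans (cong suc (𝟙-no (P? B) ¬PB)) (sym (𝟙-yes (Q? B) QB))))

  -- A missing member would make the first count strictly smaller. This is how extremal families are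
  -- recovered from tight bounds.
  count-full : (∀ A → P A → Q A) → count P? ≡ count Q? → ∀ A → Q A → P A
  count-full P⇒Q eq A QA with P? A
  ... | yes PA = PA
  ... | no ¬PA = contradiction eq (<⇒≢ (count-mono-< P⇒Q A ¬PA QA))

count≡0 : (P? : Decidable {A = Subset n} P) → (∀ A → ¬ P A) → count P? ≡ 0
count≡0 P? ¬P = Σₛ-zero λ A → 𝟙-no (P? A) (¬P A)

count≡0⁻¹ : (P? : Decidable {A = Subset n} P) → count P? ≡ 0 → ∀ A → ¬ P A
count≡0⁻¹ {n} P? eq A PA =
  contradiction (trans (count≡0 {P = λ _ → ⊥} never λ _ x → x) (sym eq)) (<⇒≢ (count-mono-< {P = λ _ → ⊥} never P? (λ _ ()) A (λ x → x) PA))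
  where
  never : Decidable {A = Subset n} (λ _ → ⊥)
  never _ = no λ x → x

count-size-suc : ∀ n k → count (λ (A : Subset n) → suc ∣ A ∣ ≟ suc k) ≡ count (λ (A : Subset n) → ∣ A ∣ ≟ k)
count-size-suc n k = count-cong (λ (A : Subset n) → suc ∣ A ∣ ≟ suc k) (λ (A : Subset n) → ∣ A ∣ ≟ k) (λ _ → suc-injective) (λ _ → cong suc)

count-size : ∀ n k → count (λ (A : Subset n) → ∣ A ∣ ≟ k) ≡ n C k
count-size zero    zero    = refl
count-size zero    (suc k) = sym (k>n⇒nCk≡0 {0} {suc k} (s≤s z≤n))
count-size (suc n) zero    = cong₂ _+_
  (count≡0 (λ (A : Subset n) → suc ∣ A ∣ ≟ 0) (λ _ ()))
  (count-size n 0)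
count-size (suc n) (suc k) = trans
  (cong₂ _+_ (trans (count-size-suc n k) (count-size n k)) (count-size n (suc k)))
  (nCk+nC[k+1]≡[n+1]C[k+1] n k)

-- Disjoint subsets and their number

Disjoint : Subset n → Subset n → Set
Disjoint A B = ∀ x → x ∈ₛ A → x ∉ₛ B

Disjoint-sym : ∀ {A B : Subset n} → Disjoint A B → Disjoint B A
Disjoint-sym A⊥B x x∈B x∈A = A⊥B x x∈A x∈B

Disjoint? : (A B : Subset n) → Dec (Disjoint A B)
Disjoint? A B = map′
  (λ e x x∈A x∈B → e (x , x∈p∩q⁺ (x∈A , x∈B)))
  (λ A⊥B (x , x∈) → let x∈A , x∈B = x∈p∩q⁻ A B x∈ in A⊥B x x∈A x∈B)
  (¬? (nonempty? (A ∩ B)))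

Disjoint-drop : ∀ {a b} {A B : Subset n} → Disjoint (a ∷ A) (b ∷ B) → Disjoint A B
Disjoint-drop d x x∈A x∈B = d (suc x) (there x∈A) (there x∈B)

Disjoint-outˡ : ∀ {b} {A B : Subset n} → Disjoint A B → Disjoint (outside ∷ A) (b ∷ B)
Disjoint-outˡ d (suc x) (there x∈A) (there x∈B) = d x x∈A x∈B

Disjoint-outʳ : ∀ {a} {A B : Subset n} → Disjoint A B → Disjoint (a ∷ A) (outside ∷ B)
Disjoint-outʳ d (suc x) (there x∈A) (there x∈B) = d x x∈A x∈B

-- `B` ranges over the `j`-subsets of the complement of `A`: an inside head of `A` forces an outside
-- head of `B`, while an outside head of `A` leaves both choices, which Pascal's rule adds.
count-disjoint : (A : Subset n) → ∀ j →
  count (λ B → Disjoint? A B ×-dec ∣ B ∣ ≟ j) ≡ (n ∸ ∣ A ∣) C j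
count-disjoint []            j = trans
  (count-cong (λ B → Disjoint? [] B ×-dec ∣ B ∣ ≟ j) (λ B → ∣ B ∣ ≟ j) (λ _ → proj₂) (λ _ e → (λ _ ()) , e))
  (count-size 0 j)
count-disjoint (inside  ∷ A) j = cong₂ _+_
  (count≡0 (λ B → Disjoint? (inside ∷ A) (inside ∷ B) ×-dec suc ∣ B ∣ ≟ j) λ _ (d , _) → d zero here here)
  (trans (count-cong (λ B → Disjoint? (inside ∷ A) (outside ∷ B) ×-dec ∣ B ∣ ≟ j) (λ B → Disjoint? A B ×-dec ∣ B ∣ ≟ j)
           (λ _ (d , e) → Disjoint-drop d , e) (λ _ (d , e) → Disjoint-outʳ d , e))
         (count-disjoint A j))
count-disjoint {suc n} (outside ∷ A) j = trans
  (cong (count (λ B → Disjoint? (outside ∷ A) (inside ∷ B) ×-dec suc ∣ B ∣ ≟ j) +_)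
    (trans (count-cong (λ B → Disjoint? (outside ∷ A) (outside ∷ B) ×-dec ∣ B ∣ ≟ j) (λ B → Disjoint? A B ×-dec ∣ B ∣ ≟ j)
             (λ _ (d , e) → Disjoint-drop d , e) (λ _ (d , e) → Disjoint-outˡ d , e))
           (count-disjoint A j)))
  (pascal j)
  where
  pascal : ∀ j → count (λ B → Disjoint? (outside ∷ A) (inside ∷ B) ×-dec suc ∣ B ∣ ≟ j) + (n ∸ ∣ A ∣) C j
               ≡ (suc n ∸ ∣ A ∣) C j
  pascal zero    = cong (_+ 1)
    (count≡0 (λ B → Disjoint? (outside ∷ A) (inside ∷ B) ×-dec suc ∣ B ∣ ≟ 0) (λ _ ()))
  pascal (suc j) = begin
    _ + (n ∸ ∣ A ∣) C suc j
      ≡⟨ cong (_+ (n ∸ ∣ A ∣) C suc j) (count-cong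
           (λ B → Disjoint? (outside ∷ A) (inside ∷ B) ×-dec suc ∣ B ∣ ≟ suc j)
           (λ B → Disjoint? A B ×-dec ∣ B ∣ ≟ j)
           (λ _ (d , e) → Disjoint-drop d , suc-injective e) (λ _ (d , e) → Disjoint-outˡ d , cong suc e)) ⟩
    count (λ B → Disjoint? A B ×-dec ∣ B ∣ ≟ j) + (n ∸ ∣ A ∣) C suc j
      ≡⟨ cong (_+ (n ∸ ∣ A ∣) C suc j) (count-disjoint A j) ⟩
    (n ∸ ∣ A ∣) C j + (n ∸ ∣ A ∣) C suc j
      ≡⟨ nCk+nC[k+1]≡[n+1]C[k+1] (n ∸ ∣ A ∣) j ⟩
    suc (n ∸ ∣ A ∣) C suc j
      ≡⟨ cong (_C suc j) (sym (+-∸-assoc 1 (∣p∣≤n A))) ⟩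
    (suc n ∸ ∣ A ∣) C suc j ∎
    where open ≡-Reasoning

-- Cross-intersecting families

-- On `i + j + t` points, `(i + t) C i` is the number of `i`-sets disjoint from a given `j`-set.
-- Pascal's rule shows that it grows with `i`, so in the disjointness graph the smaller sets have
-- the larger degree.
[i+t]Ci-step : ∀ i t → (i + t) C i ≤ (suc i + t) C suc i
[i+t]Ci-step i t = ≤-trans (m≤m+n _ ((i + t) C suc i)) (≤-reflexive (nCk+nC[k+1]≡[n+1]C[k+1] (i + t) i))

[i+t]Ci-mono : ∀ {i j} t → i ≤′ j → (i + t) C i ≤ (j + t) C j
[i+t]Ci-mono t (≤′-reflexive refl) = ≤-refl
[i+t]Ci-mono t (≤′-step {j} i≤j) = ≤-trans ([i+t]Ci-mono t i≤j) ([i+t]Ci-step j t)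

[i+t]Ci>0 : ∀ i t → 0 < (i + t) C i
[i+t]Ci>0 i t = [i+t]Ci-mono t (≤⇒≤′ (z≤n {i}))

-- The increment in Pascal's rule, `(i + suc t) C suc i`, is positive. With 0 in place of `suc t`
-- all these binomials would equal 1.
[i+t]Ci-mono-< : ∀ {i j} t → i < j → (i + suc t) C i < (j + suc t) C j
[i+t]Ci-mono-< {i} t i<j = <-≤-trans
  (subst ((i + suc t) C i <_) (nCk+nC[k+1]≡[n+1]C[k+1] (i + suc t) i)
    (m<m+n _ (subst (λ l → 0 < l C suc i) (sym (+-suc i t)) ([i+t]Ci>0 (suc i) t))))
  ([i+t]Ci-mono (suc t) (≤⇒≤′ i<j))

Uniform : ℕ → Pred (Subset n) 0ℓ → Set
Uniform k P = ∀ A → P A → ∣ A ∣ ≡ k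

CrossIntersecting : Pred (Subset n) 0ℓ → Pred (Subset n) 0ℓ → Set
CrossIntersecting P Q = ∀ A B → P A → Q B → ¬ Disjoint A B

Intersecting : Pred (Subset n) 0ℓ → Set
Intersecting P = CrossIntersecting P P

module _ {P Q : Pred (Subset n) 0ℓ} (P? : Decidable P) (Q? : Decidable Q)
         {i j t : ℕ} (n≡ : n ≡ i + j + t)
         (P-uniform : Uniform i P) (Q-uniform : Uniform j Q) (P×Q : CrossIntersecting P Q) where

  private
    edge : Subset n → Subset n → ℕ
    edge A B = 𝟙 (P? A) * 𝟙 (Disjoint? A B ×-dec ∣ B ∣ ≟ j)

    n∸i≡ : n ∸ i ≡ j + t
    n∸i≡ = trans (cong (_∸ i) (trans n≡ (+-assoc i j t))) (m+n∸m≡n i (j + t))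

    n∸j≡ : n ∸ j ≡ i + t
    n∸j≡ = trans (cong (_∸ j) (trans n≡ (swap₁ i j t))) (m+n∸m≡n j (i + t))
      where
      swap₁ : ∀ a b c → a + b + c ≡ b + (a + c)
      swap₁ = solve-∀

    degree-P : ∀ A → 𝟙 (P? A) * ((j + t) C j) ≡ Σₛ (edge A)
    degree-P A with P? A
    ... | no _   = sym (Σₛ-zero {f = λ B → 0 * 𝟙 (Disjoint? A B ×-dec ∣ B ∣ ≟ j)} λ _ → refl)
    ... | yes pA = begin
      1 * ((j + t) C j)      ≡⟨ cong (λ l → 1 * (l C j)) (trans (sym n∸i≡) (cong (n ∸_) (sym (P-uniform A pA)))) ⟩
      1 * ((n ∸ ∣ A ∣) C j)  ≡⟨ cong (1 *_) (count-disjoint A j) ⟨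
      1 * count (λ B → Disjoint? A B ×-dec ∣ B ∣ ≟ j) ≡⟨ Σₛ-*ˡ 1 (λ B → 𝟙 (Disjoint? A B ×-dec ∣ B ∣ ≟ j)) ⟨
      Σₛ (λ B → 1 * 𝟙 (Disjoint? A B ×-dec ∣ B ∣ ≟ j)) ∎
      where open ≡-Reasoning

    no-edge : ∀ A B → (P A → Disjoint A B → ∣ B ∣ ≡ j → ⊥) → edge A B ≡ 0
    no-edge A B h with P? A
    ... | no _   = refl
    ... | yes pA = cong (1 *_) (𝟙-no (Disjoint? A B ×-dec ∣ B ∣ ≟ j) λ (d , e) → h pA d e)

    -- A member of `Q` has no edge into `P`, and every other `j`-set has at most `(i + t) C i`
    -- edges. Charging each member of `Q` a full degree therefore stays within the allowance of its
    -- `j`-set.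
    degree-Q : ∀ B → Σₛ (λ A → edge A B) + 𝟙 (Q? B) * ((i + t) C i) ≤ 𝟙 (∣ B ∣ ≟ j) * ((i + t) C i)
    degree-Q B with Q? B
    ... | yes qB = ≤-reflexive (cong₂ (λ a b → a + b * ((i + t) C i))
                     (Σₛ-zero λ A → no-edge A B λ pA d _ → P×Q A B pA qB d)
                     (sym (𝟙-yes (∣ B ∣ ≟ j) (Q-uniform B qB))))
    ... | no _   with ∣ B ∣ ≟ j
    ...   | no ∣B∣≢j  = subst (_≤ 𝟙 (∣ B ∣ ≟ j) * ((i + t) C i))
                        (sym (cong (_+ 0) (Σₛ-zero λ A → no-edge A B λ _ _ → ∣B∣≢j))) z≤n
    ...   | yes ∣B∣≡j = begin
      Σₛ (λ A → edge A B) + 0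
        ≡⟨ +-identityʳ _ ⟩
      Σₛ (λ A → edge A B)
        ≤⟨ Σₛ-mono-≤ edge≤ ⟩
      count (λ A → Disjoint? B A ×-dec ∣ A ∣ ≟ i)
        ≡⟨ count-disjoint B i ⟩
      (n ∸ ∣ B ∣) C i
        ≡⟨ cong (_C i) (trans (cong (n ∸_) ∣B∣≡j) n∸j≡) ⟩
      (i + t) C i
        ≡⟨ *-identityˡ _ ⟨
      1 * ((i + t) C i)
        ≡⟨ cong (_* ((i + t) C i)) (𝟙-yes (∣ B ∣ ≟ j) ∣B∣≡j) ⟨
      𝟙 (∣ B ∣ ≟ j) * ((i + t) C i) ∎
      where
      open ≤-Reasoning
      edge≤ : ∀ A → edge A B ≤ 𝟙 (Disjoint? B A ×-dec ∣ A ∣ ≟ i)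
      edge≤ A with P? A
      ... | no _   = z≤n
      ... | yes pA = ≤-trans (≤-reflexive (*-identityˡ _))
                       (𝟙-mono (Disjoint? A B ×-dec ∣ B ∣ ≟ j) (Disjoint? B A ×-dec ∣ A ∣ ≟ i)
                         λ (d , _) → Disjoint-sym d , P-uniform A pA)

  -- Double counting of the disjoint pairs (A, B) with A in P and ∣ B ∣ = j.
  cross-weighted : count P? * ((j + t) C j) + count Q? * ((i + t) C i) ≤ (n C j) * ((i + t) C i)
  cross-weighted = begin
    count P? * ((j + t) C j) + count Q? * ((i + t) C i)
      ≡⟨ cong₂ _+_ (Σₛ-*ʳ (λ A → 𝟙 (P? A)) _) (Σₛ-*ʳ (λ B → 𝟙 (Q? B)) _) ⟨
    Σₛ (λ A → 𝟙 (P? A) * ((j + t) C j)) + Σₛ (λ B → 𝟙 (Q? B) * ((i + t) C i))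
      ≡⟨ cong (_+ Σₛ (λ B → 𝟙 (Q? B) * ((i + t) C i))) (trans (Σₛ-cong degree-P) (Σₛ-swap edge)) ⟩
    Σₛ (λ B → Σₛ (λ A → edge A B)) + Σₛ (λ B → 𝟙 (Q? B) * ((i + t) C i))
      ≡⟨ Σₛ-+ (λ B → Σₛ (λ A → edge A B)) _ ⟨
    Σₛ (λ B → Σₛ (λ A → edge A B) + 𝟙 (Q? B) * ((i + t) C i))
      ≤⟨ Σₛ-mono-≤ degree-Q ⟩
    Σₛ (λ (B : Subset n) → 𝟙 (∣ B ∣ ≟ j) * ((i + t) C i))
      ≡⟨ Σₛ-*ʳ (λ (B : Subset n) → 𝟙 (∣ B ∣ ≟ j)) _ ⟩
    count (λ (B : Subset n) → ∣ B ∣ ≟ j) * ((i + t) C i)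
      ≡⟨ cong (_* ((i + t) C i)) (count-size n j) ⟩
    (n C j) * ((i + t) C i) ∎
    where open ≤-Reasoning

  -- For `i ≤ j` the weight of `P` in `cross-weighted` is at least that of `Q`; lowering it to the
  -- latter lets the common factor cancel.
  cross-bound : i ≤ j → count P? + count Q? ≤ n C j
  cross-bound i≤j = *-cancelʳ-≤ _ _ ((i + t) C i) {{>-nonZero ([i+t]Ci>0 i t)}} (begin
    (count P? + count Q?) * ((i + t) C i)
      ≡⟨ *-distribʳ-+ _ (count P?) _ ⟩
    count P? * ((i + t) C i) + count Q? * ((i + t) C i)
      ≤⟨ +-monoˡ-≤ _ (*-monoʳ-≤ (count P?) ([i+t]Ci-mono t (≤⇒≤′ i≤j))) ⟩
    count P? * ((j + t) C j) + count Q? * ((i + t) C i)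
      ≤⟨ cross-weighted ⟩
    (n C j) * ((i + t) C i) ∎)
    where open ≤-Reasoning

-- With `i < j` and a point to spare, the weight of `P` strictly exceeds that of `Q`, so a single
-- member of `P` would make the weighted count too large.
cross-equality : {P Q : Pred (Subset n) 0ℓ} (P? : Decidable P) (Q? : Decidable Q) →
  ∀ {i j t} → n ≡ i + j + suc t → Uniform i P → Uniform j Q → CrossIntersecting P Q →
  i < j → count P? + count Q? ≡ n C j → count P? ≡ 0
cross-equality {n} P? Q? {i} {j} {t} n≡ P-uniform Q-uniform P×Q i<j eq with count P? in ∣P∣
... | zero  = refl
... | suc p = contradiction (begin-strict
    (n C j) * ((i + suc t) C i)
      ≡⟨ cong (_* ((i + suc t) C i)) eq ⟨
    (suc p + count Q?) * ((i + suc t) C i)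
      ≡⟨ *-distribʳ-+ _ (suc p) (count Q?) ⟩
    suc p * ((i + suc t) C i) + count Q? * ((i + suc t) C i)
      <⟨ +-monoˡ-< _ (*-monoʳ-< (suc p) ([i+t]Ci-mono-< t i<j)) ⟩
    suc p * ((j + suc t) C j) + count Q? * ((i + suc t) C i)
      ≡⟨ cong (λ a → a * ((j + suc t) C j) + count Q? * ((i + suc t) C i)) ∣P∣ ⟨
    count P? * ((j + suc t) C j) + count Q? * ((i + suc t) C i)
      ≤⟨ cross-weighted P? Q? n≡ P-uniform Q-uniform P×Q ⟩
    (n C j) * ((i + suc t) C i) ∎) (<-irrefl refl)
    where open ≤-Reasoning

-- Exchanging elements

infixl 6 _∪ᵢ_ _∖ᵢ_

_∪ᵢ_ : Subset n → Fin n → Subset n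
A ∪ᵢ i = A [ i ]≔ inside

_∖ᵢ_ : Subset n → Fin n → Subset n
A ∖ᵢ i = A [ i ]≔ outside

i∈A∪i : ∀ (A : Subset n) i → i ∈ₛ A ∪ᵢ i
i∈A∪i A i = Vec.[]≔-updates A i

i∉A∖i : ∀ (A : Subset n) i → i ∉ₛ A ∖ᵢ i
i∉A∖i (a ∷ A) (suc i) (there i∈) = i∉A∖i A i i∈

A⊆A∪i : ∀ {A : Subset n} {x} i → x ∈ₛ A → x ∈ₛ A ∪ᵢ i
A⊆A∪i zero    here        = here
A⊆A∪i zero    (there x∈A) = there x∈A
A⊆A∪i (suc i) here        = here
A⊆A∪i (suc i) (there x∈A) = there (A⊆A∪i i x∈A)

x∈A∪i⁻ : ∀ (A : Subset n) {x} i → x ∈ₛ A ∪ᵢ i → x ≡ i ⊎ x ∈ₛ A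
x∈A∪i⁻ (a ∷ A) zero    here       = inj₁ refl
x∈A∪i⁻ (a ∷ A) zero    (there x∈) = inj₂ (there x∈)
x∈A∪i⁻ (a ∷ A) (suc i) here       = inj₂ here
x∈A∪i⁻ (a ∷ A) (suc i) (there x∈) with x∈A∪i⁻ A i x∈
... | inj₁ refl = inj₁ refl
... | inj₂ x∈A  = inj₂ (there x∈A)

A∖i⊆A : ∀ (A : Subset n) {x} i → x ∈ₛ A ∖ᵢ i → x ∈ₛ A
A∖i⊆A (a ∷ A) zero    (there x∈) = there x∈
A∖i⊆A (a ∷ A) (suc i) here       = here
A∖i⊆A (a ∷ A) (suc i) (there x∈) = there (A∖i⊆A A i x∈)

∣A∪i∣ : ∀ (A : Subset n) i → i ∉ₛ A → ∣ A ∪ᵢ i ∣ ≡ suc ∣ A ∣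
∣A∪i∣ (inside  ∷ A) zero    i∉A = contradiction here i∉A
∣A∪i∣ (outside ∷ A) zero    i∉A = refl
∣A∪i∣ (inside  ∷ A) (suc i) i∉A = cong suc (∣A∪i∣ A i (i∉A ∘ there))
∣A∪i∣ (outside ∷ A) (suc i) i∉A = ∣A∪i∣ A i (i∉A ∘ there)

∣A∖i∣ : ∀ (A : Subset n) i → i ∈ₛ A → suc ∣ A ∖ᵢ i ∣ ≡ ∣ A ∣
∣A∖i∣ (inside  ∷ A) zero    i∈A         = refl
∣A∖i∣ (inside  ∷ A) (suc i) (there i∈A) = cong suc (∣A∖i∣ A i i∈A)
∣A∖i∣ (outside ∷ A) (suc i) (there i∈A) = ∣A∖i∣ A i i∈A

A∖i∪i : ∀ (A : Subset n) i → i ∈ₛ A → A ∖ᵢ i ∪ᵢ i ≡ A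
A∖i∪i (inside ∷ A) zero    here        = refl
A∖i∪i (a ∷ A)      (suc i) (there i∈A) = cong (a ∷_) (A∖i∪i A i i∈A)

A∪i∖i : ∀ (A : Subset n) i → i ∉ₛ A → A ∪ᵢ i ∖ᵢ i ≡ A
A∪i∖i (inside  ∷ A) zero    i∉A = contradiction here i∉A
A∪i∖i (outside ∷ A) zero    i∉A = refl
A∪i∖i (a ∷ A)       (suc i) i∉A = cong (a ∷_) (A∪i∖i A i (i∉A ∘ there))

∃-disjoint : ∀ (A : Subset n) j → ∣ A ∣ + j ≤ n → ∃ λ B → Disjoint A B × ∣ B ∣ ≡ j
∃-disjoint {n} A zero _ = ∅ , (λ _ _ → ∉⊥) , ∣⊥∣≡0 n
∃-disjoint []            (suc j) ()
∃-disjoint (inside  ∷ A) (suc j) (s≤s p) with ∃-disjoint A (suc j) p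
... | B , d , e = outside ∷ B , Disjoint-outʳ d , e
∃-disjoint {suc n} (outside ∷ A) (suc j) p with ∃-disjoint A j (s≤s⁻¹ (subst (_≤ suc n) (+-suc ∣ A ∣ j) p))
... | B , d , e = inside ∷ B , Disjoint-outˡ d , cong suc e

∃-∉ : ∀ (A : Subset n) → ∣ A ∣ < n → ∃ λ x → x ∉ₛ A
∃-∉ (inside  ∷ A) (s≤s p) = let x , x∉A = ∃-∉ A p in suc x , λ { (there x∈A) → x∉A x∈A }
∃-∉ (outside ∷ A) p       = zero , λ ()

excess : ∀ (A B : Subset n) → ∣ A ∣ ≡ ∣ B ∣ → A ≡ B ⊎ ∃ λ x → x ∈ₛ A × x ∉ₛ B
excess A B eq with any? (λ x → x ∈? A ×-dec ¬? (x ∈? B))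
... | yes p = inj₂ p
... | no ¬p = inj₁ (⊆-antisym A⊆B B⊆A)
  where
  A⊆B : A ⊆ₛ B
  A⊆B {x} x∈A with x ∈? B
  ... | yes x∈B = x∈B
  ... | no x∉B  = contradiction (x , x∈A , x∉B) ¬p
  B⊆A : B ⊆ₛ A
  B⊆A {x} x∈B with x ∈? A
  ... | yes x∈A = x∈A
  ... | no x∉A  = contradiction eq (<⇒≢ (p⊂q⇒∣p∣<∣q∣ (A⊆B , x , x∈B , x∉A)))

-- Connectivity of the Kneser graph: two j-sets that differ by exchanging a for b have a common neighbour.
module _ (i : Fin n) (j : ℕ) (2+2j≤n : 2 + j + j ≤ n) {P : Pred (Subset n) 0ℓ}
  (P-closed : ∀ A B → i ∉ₛ A → i ∉ₛ B → ∣ A ∣ ≡ j → ∣ B ∣ ≡ j → Disjoint A B → P A → P B) where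

  private
    exchange : ∀ A a b → i ∉ₛ A → b ≢ i → ∣ A ∣ ≡ j → a ∈ₛ A → b ∉ₛ A → P A →
               let A′ = A ∖ᵢ a ∪ᵢ b in i ∉ₛ A′ × ∣ A′ ∣ ≡ j × P A′
    -- The common neighbour `D` must avoid `A`, `b` and `i`, which are `j + 2` points; hence the
    -- bound `2 + j + j ≤ n`. Membership passes from `A` to `D` and from `D` to `A′`.
    exchange A a b i∉A b≢i ∣A∣≡j a∈A b∉A pA with ∃-disjoint (A ∪ᵢ b ∪ᵢ i) j
      (subst (λ l → l + j ≤ n) (sym (trans (∣A∪i∣ (A ∪ᵢ b) i ([ b≢i ∘ sym , i∉A ]′ ∘ x∈A∪i⁻ A b))
                                    (cong suc (trans (∣A∪i∣ A b b∉A) (cong suc ∣A∣≡j))))) 2+2j≤n)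
    ... | D , d , ∣D∣≡j = i∉A′ , ∣A′∣≡j , P-closed D A′ i∉D i∉A′ ∣D∣≡j ∣A′∣≡j (Disjoint-sym A′⊥D)
        (P-closed A D i∉A i∉D ∣A∣≡j ∣D∣≡j (λ x x∈A → d x (A⊆A∪i i (A⊆A∪i b x∈A))) pA)
      where
      A′ = A ∖ᵢ a ∪ᵢ b
      i∉D : i ∉ₛ D
      i∉D = d i (i∈A∪i (A ∪ᵢ b) i)
      i∉A′ : i ∉ₛ A ∖ᵢ a ∪ᵢ b
      i∉A′ = [ b≢i ∘ sym , i∉A ∘ A∖i⊆A A a ]′ ∘ x∈A∪i⁻ (A ∖ᵢ a) b
      ∣A′∣≡j : ∣ A ∖ᵢ a ∪ᵢ b ∣ ≡ j
      ∣A′∣≡j = trans (∣A∪i∣ (A ∖ᵢ a) b (b∉A ∘ A∖i⊆A A a)) (trans (∣A∖i∣ A a a∈A) ∣A∣≡j)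
      A′⊥D : Disjoint (A ∖ᵢ a ∪ᵢ b) D
      A′⊥D x x∈A′ with x∈A∪i⁻ (A ∖ᵢ a) b x∈A′
      ... | inj₁ refl = d b (A⊆A∪i i (i∈A∪i A b))
      ... | inj₂ x∈   = d x (A⊆A∪i i (A⊆A∪i b (A∖i⊆A A a x∈)))

    -- Induction on a bound `l` for the size of the difference of `A` and `B`: trading an `a` in `A`
    -- only for a `b` in `B` only removes `a` from that difference.
    connect : ∀ l A B → ∣ A ∩ ∁ B ∣ < l → i ∉ₛ A → i ∉ₛ B → ∣ A ∣ ≡ j → ∣ B ∣ ≡ j → P A → P B
    connect (suc l) A B (s≤s A─B<l) i∉A i∉B ∣A∣≡j ∣B∣≡j pA
      with excess A B (trans ∣A∣≡j (sym ∣B∣≡j)) | excess B A (trans ∣B∣≡j (sym ∣A∣≡j))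
    ... | inj₁ refl | _         = pA
    ... | inj₂ _    | inj₁ refl = pA
    ... | inj₂ (a , a∈A , a∉B) | inj₂ (b , b∈B , b∉A)
      with exchange A a b i∉A (λ { refl → i∉B b∈B }) ∣A∣≡j a∈A b∉A pA
    ...   | i∉A′ , ∣A′∣≡j , pA′ = connect l (A ∖ᵢ a ∪ᵢ b) B (<-≤-trans (p⊂q⇒∣p∣<∣q∣ (sub , a , a∈A─B , a∉A′─B)) A─B<l)
                                    i∉A′ i∉B ∣A′∣≡j ∣B∣≡j pA′
      where
      A′ = A ∖ᵢ a ∪ᵢ b
      sub : A′ ∩ ∁ B ⊆ₛ A ∩ ∁ B
      sub x∈ with x∈p∩q⁻ A′ (∁ B) x∈
      ... | x∈A′ , x∈∁B with x∈A∪i⁻ (A ∖ᵢ a) b x∈A′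
      ...   | inj₁ refl = contradiction b∈B (x∈∁p⇒x∉p x∈∁B)
      ...   | inj₂ x∈A∖a = x∈p∩q⁺ (A∖i⊆A A a x∈A∖a , x∈∁B)
      a∈A─B : a ∈ₛ A ∩ ∁ B
      a∈A─B = x∈p∩q⁺ (a∈A , x∉p⇒x∈∁p a∉B)
      a∉A′─B : a ∉ₛ A′ ∩ ∁ B
      a∉A′─B a∈ with x∈A∪i⁻ (A ∖ᵢ a) b (proj₁ (x∈p∩q⁻ A′ (∁ B) a∈))
      ... | inj₁ refl = a∉B b∈B
      ... | inj₂ a∈A∖a = i∉A∖i A a a∈A∖a

  kneser-connected : ∀ A B → i ∉ₛ A → i ∉ₛ B → ∣ A ∣ ≡ j → ∣ B ∣ ≡ j → P A → P B
  kneser-connected A B = connect (suc ∣ A ∩ ∁ B ∣) A B ≤-refl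

-- Shifting

-- The element zero is replaced by i wherever the result is not yet a member.  Shifts away from zero suffice, as
-- only the link of zero has to become intersecting.
Shift : Pred (Subset (suc n)) 0ℓ → Fin n → Pred (Subset (suc n)) 0ℓ
Shift P i (inside  ∷ A) = P (inside ∷ A) × (i ∈ₛ A ⊎ P (outside ∷ A ∪ᵢ i))
Shift P i (outside ∷ A) = P (outside ∷ A) ⊎ (i ∈ₛ A × P (inside ∷ A ∖ᵢ i))

Shift? : {P : Pred (Subset (suc n)) 0ℓ} → Decidable P → ∀ i → Decidable (Shift P i)
Shift? P? i (inside  ∷ A) = P? (inside ∷ A) ×-dec (i ∈? A ⊎-dec P? (outside ∷ A ∪ᵢ i))
Shift? P? i (outside ∷ A) = P? (outside ∷ A) ⊎-dec (i ∈? A ×-dec P? (inside ∷ A ∖ᵢ i))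

Shifted : Pred (Subset (suc n)) 0ℓ → Set
Shifted P = ∀ i A → P (inside ∷ A) → i ∉ₛ A → P (outside ∷ A ∪ᵢ i)

-- For `i ∉ A` the pair `P₁ A`, `P₀ (A ∪ᵢ i)` is replaced by its conjunction and its disjunction,
-- which preserves the sum of the two indicators; everything else stays. Keeping link and deletion
-- as two separate families lets the induction descend along `i`.
count-exchange : {P₁ P₀ : Pred (Subset n) 0ℓ} (P₁? : Decidable P₁) (P₀? : Decidable P₀) (i : Fin n) →
  count (λ A → P₁? A ×-dec (i ∈? A ⊎-dec P₀? (A ∪ᵢ i))) +
  count (λ A → P₀? A ⊎-dec (i ∈? A ×-dec P₁? (A ∖ᵢ i))) ≡ count P₁? + count P₀?
count-exchange {suc n} {P₁} {P₀} P₁? P₀? zero = begin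
  (count up₁ + count up₀) + (count down₁ + count down₀)
    ≡⟨ regroup (count up₁) _ _ _ ⟩
  (count up₁ + count down₀) + (count up₀ + count down₁)
    ≡⟨ cong₂ _+_ (cong₂ _+_ (count-cong up₁ (λ A → P₁? (inside ∷ A)) (λ _ → proj₁) (λ _ p → p , inj₁ here))
                            (count-cong down₀ (λ A → P₀? (outside ∷ A)) (λ { _ (inj₁ p) → p ; _ (inj₂ ()) }) (λ _ → inj₁)))
                 (trans (sym (Σₛ-+ (λ A → 𝟙 (up₀ A)) _)) (trans (Σₛ-cong swap) (Σₛ-+ (λ A → 𝟙 (P₁? (outside ∷ A))) _))) ⟩
  (count (λ A → P₁? (inside ∷ A)) + count (λ A → P₀? (outside ∷ A))) +
  (count (λ A → P₁? (outside ∷ A)) + count (λ A → P₀? (inside ∷ A)))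
    ≡⟨ regroup′ (count (λ A → P₁? (inside ∷ A))) _ _ _ ⟩
  count P₁? + count P₀? ∎
  where
  open ≡-Reasoning
  regroup : ∀ a b c d → (a + b) + (c + d) ≡ (a + d) + (b + c)
  regroup = solve-∀
  regroup′ : ∀ a b c d → (a + b) + (c + d) ≡ (a + c) + (d + b)
  regroup′ = solve-∀
  up₁ up₀ down₁ down₀ : (A : Subset n) → Dec _
  up₁ A   = P₁? (inside ∷ A) ×-dec (zero ∈? (inside ∷ A) ⊎-dec P₀? (inside ∷ A))
  up₀ A   = P₁? (outside ∷ A) ×-dec (zero ∈? (outside ∷ A) ⊎-dec P₀? (inside ∷ A))
  down₁ A = P₀? (inside ∷ A) ⊎-dec (zero ∈? (inside ∷ A) ×-dec P₁? (outside ∷ A))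
  down₀ A = P₀? (outside ∷ A) ⊎-dec (zero ∈? (outside ∷ A) ×-dec P₁? (outside ∷ A))
  swap : ∀ A → 𝟙 (up₀ A) + 𝟙 (down₁ A) ≡ 𝟙 (P₁? (outside ∷ A)) + 𝟙 (P₀? (inside ∷ A))
  swap A with P₁? (outside ∷ A) | P₀? (inside ∷ A)
  ... | yes _ | yes _ = refl
  ... | yes _ | no _  = refl
  ... | no _  | yes _ = refl
  ... | no _  | no _  = refl
count-exchange {suc n} P₁? P₀? (suc i) = trans (interchange (count (λ A → P₁? (inside ∷ A) ×-dec (i ∈? A ⊎-dec P₀? (inside ∷ A ∪ᵢ i)))) _ _ _)
  (trans (cong₂ _+_ (count-exchange (λ A → P₁? (inside ∷ A)) (λ A → P₀? (inside ∷ A)) i)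
                    (count-exchange (λ A → P₁? (outside ∷ A)) (λ A → P₀? (outside ∷ A)) i))
         (interchange (count (λ A → P₁? (inside ∷ A))) _ _ _))

module _ {P : Pred (Subset (suc n)) 0ℓ} (i : Fin n) where

  count-shift : (P? : Decidable P) → count (Shift? P? i) ≡ count P?
  count-shift P? = count-exchange (λ A → P? (inside ∷ A)) (λ A → P? (outside ∷ A)) i

  shift-uniform : Uniform k P → Uniform k (Shift P i)
  shift-uniform u (inside  ∷ A) (p , _)          = u _ p
  shift-uniform u (outside ∷ A) (inj₁ p)         = u _ p
  shift-uniform u (outside ∷ A) (inj₂ (i∈A , p)) = trans (sym (∣A∖i∣ A i i∈A)) (u _ p)

  private
    -- If `B` is new and `A` stayed because `A ∪ᵢ i` was already present, the replacement of the one
    -- and the original of the other are members of `P`. Swapping `zero` and `i` in both sets keeps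
    -- them disjoint.
    across : Intersecting P → ∀ A B → Shift P i (inside ∷ A) → Shift P i (outside ∷ B) →
             ¬ Disjoint (inside ∷ A) (outside ∷ B)
    across I A B (pA , _) (inj₁ pB) d = I _ _ pA pB d
    across I A B (pA , inj₁ i∈A) (inj₂ (i∈B , _)) d = d (suc i) (there i∈A) (there i∈B)
    across I A B (_ , inj₂ pA) (inj₂ (_ , pB)) d = I _ _ pA pB (Disjoint-outˡ disj)
      where
      disj : Disjoint (A ∪ᵢ i) (B ∖ᵢ i)
      disj x x∈A∪i x∈B∖i with x∈A∪i⁻ A i x∈A∪i
      ... | inj₁ refl = i∉A∖i B i x∈B∖i
      ... | inj₂ x∈A  = Disjoint-drop d x x∈A (A∖i⊆A B i x∈B∖i)

  shift-intersecting : Intersecting P → Intersecting (Shift P i)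
  shift-intersecting I (inside ∷ A) (inside ∷ B) _ _ d = d zero here here
  shift-intersecting I (inside ∷ A) (outside ∷ B) pA pB d = across I A B pA pB d
  shift-intersecting I (outside ∷ A) (inside ∷ B) pA pB d =
    across I B A pB pA (Disjoint-sym d)
  shift-intersecting I (outside ∷ A) (outside ∷ B) (inj₁ pA) (inj₁ pB) d = I _ _ pA pB d
  shift-intersecting I (outside ∷ A) (outside ∷ B) (inj₁ pA) (inj₂ (_ , pB)) d =
    I _ _ pA pB (Disjoint-outˡ λ x x∈A x∈B → Disjoint-drop d x x∈A (A∖i⊆A B i x∈B))
  shift-intersecting I (outside ∷ A) (outside ∷ B) (inj₂ (_ , pA)) (inj₁ pB) d =
    I _ _ pA pB (Disjoint-outʳ λ x x∈A x∈B → Disjoint-drop d x (A∖i⊆A A i x∈A) x∈B)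
  shift-intersecting I (outside ∷ A) (outside ∷ B) (inj₂ (i∈A , _)) (inj₂ (i∈B , _)) d =
    d (suc i) (there i∈A) (there i∈B)

module _ (Good : {P : Pred (Subset (suc n)) 0ℓ} → Decidable P → Set)
  (shifted⇒good : ∀ {P} (P? : Decidable P) → Shifted P → Good P?)
  (unshift : ∀ {P} (P? : Decidable P) i → Good (Shift? P? i) → Good P?) where

  private
    -- Induction on the number of members containing `zero`: a witness that `P` is not shifted at
    -- `i` leaves this part of the family under the shift at `i`.
    go : ∀ l {P} (P? : Decidable P) → count (λ A → P? (inside ∷ A)) < l → Good P?
    go (suc l) {P} P? (s≤s c≤l)
      with any? (λ i → anySubset? (λ A → P? (inside ∷ A) ×-dec ¬? (i ∈? A) ×-dec ¬? (P? (outside ∷ A ∪ᵢ i))))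
    ... | yes (i , A , p , i∉A , ¬p) = unshift P? i (go l (Shift? P? i) (<-≤-trans
            (count-mono-< (λ A → Shift? P? i (inside ∷ A)) (λ A → P? (inside ∷ A)) (λ _ → proj₁) A
              (λ { (_ , inj₁ i∈A) → i∉A i∈A ; (_ , inj₂ q) → ¬p q }) p) c≤l))
    ... | no ¬e = shifted⇒good P? shifted
      where
      shifted : Shifted P
      shifted i A p i∉A with P? (outside ∷ A ∪ᵢ i)
      ... | yes q = q
      ... | no ¬q = contradiction (i , A , p , i∉A , ¬q) ¬e

  shift-induction : ∀ {P} (P? : Decidable P) → Good P?
  shift-induction P? = go _ P? ≤-refl

-- Stars

-- C(n, k − 1), with the value 0 at k = 0, where the truncated n C (k ∸ 1) would be 1.
starSize : ℕ → ℕ → ℕ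
starSize n zero    = 0
starSize n (suc k) = n C k

starSize-suc : ∀ n k → starSize n k + n C k ≡ suc n C k
starSize-suc n zero    = refl
starSize-suc n (suc k) = nCk+nC[k+1]≡[n+1]C[k+1] n k

InStar : Fin n → ℕ → Pred (Subset n) 0ℓ
InStar c k A = ∣ A ∣ ≡ k × c ∈ₛ A

InStar? : ∀ (c : Fin n) k → Decidable (InStar c k)
InStar? c k A = ∣ A ∣ ≟ k ×-dec c ∈? A

∣A∣≡0⇒∉ : ∀ (A : Subset n) {x} → ∣ A ∣ ≡ 0 → x ∉ₛ A
∣A∣≡0⇒∉ A e x∈A = contradiction (trans (∣A∖i∣ A _ x∈A) e) λ ()

count-star : ∀ (c : Fin (suc n)) k → count (InStar? c k) ≡ starSize n k
count-star c zero = count≡0 (InStar? c zero) λ { (inside ∷ A) (() , _) ; (outside ∷ A) (e , there c∈A) → ∣A∣≡0⇒∉ A e c∈A }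
count-star {n} zero (suc k) = trans (cong₂ _+_
  (trans (count-cong (λ (A : Subset n) → InStar? zero (suc k) (inside ∷ A)) (λ (A : Subset n) → ∣ A ∣ ≟ k)
           (λ _ → suc-injective ∘ proj₁) (λ _ e → cong suc e , here))
         (count-size n k))
  (count≡0 (λ (A : Subset n) → InStar? zero (suc k) (outside ∷ A)) λ { _ (_ , ()) }))
  (+-identityʳ _)
count-star {suc n} (suc c) (suc k) = trans (cong₂ _+_
  (trans (count-cong (λ A → InStar? (suc c) (suc k) (inside ∷ A)) (InStar? c k)
           (λ { _ (e , there c∈A) → suc-injective e , c∈A }) (λ _ (e , c∈A) → cong suc e , there c∈A))
         (count-star c k))
  (trans (count-cong (λ A → InStar? (suc c) (suc k) (outside ∷ A)) (InStar? c (suc k))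
           (λ { _ (e , there c∈A) → e , c∈A }) (λ _ (e , c∈A) → e , there c∈A))
         (count-star c (suc k))))
  (starSize-suc n k)

Centre : Pred (Subset n) 0ℓ → Fin n → Set
Centre P c = ∀ A → P A → c ∈ₛ A

star-full : {P : Pred (Subset (suc n)) 0ℓ} (P? : Decidable P) → Uniform k P →
  count P? ≡ starSize n k → ∀ {c} → Centre P c → ∀ A → InStar c k A → P A
star-full {k = k} P? P-uniform eq {c} centre =
  count-full P? (InStar? c k) (λ A pA → P-uniform A pA , centre A pA) (trans eq (sym (count-star c k)))

module _ {P : Pred (Subset (suc n)) 0ℓ} (P? : Decidable P) {j : ℕ}
  (P-uniform : Uniform (suc j) P) (P-intersecting : Intersecting P) (i : Fin n) (2+2j≤n : 2 + j + j ≤ n)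
  (eq : count P? ≡ n C j) where

  private
    -- The shift is the full star at `suc i`, so for each `j`-set `B` avoiding `i`, one of
    -- `inside ∷ B` and `outside ∷ B ∪ᵢ i` lies in `P`. One member with `zero` but without `suc i`
    -- forces the first alternative on all disjoint `B`, hence by connectivity everywhere, and the
    -- centre is then `zero`.
    unshift-centre-i : Centre (Shift P i) (suc i) → ∃ (Centre P)
    unshift-centre-i centre with anySubset? (λ A → ¬? (i ∈? A) ×-dec ∣ A ∣ ≟ j ×-dec P? (inside ∷ A))
    ... | no ¬e = suc i , λ
      { (inside ∷ A) pA → case i ∈? A of λ
          { (yes i∈A) → there i∈A
          ; (no i∉A)  → contradiction (A , i∉A , suc-injective (P-uniform _ pA) , pA) ¬e }
      ; (outside ∷ A) pA → centre (outside ∷ A) (inj₁ pA) }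
    ... | yes (A₀ , i∉A₀ , ∣A₀∣≡j , pA₀) = zero , λ
      { (inside ∷ A) pA → here
      ; (outside ∷ A) pA → ⊥-elim (outside∉P A pA) }
      where
      closed : ∀ A B → i ∉ₛ A → i ∉ₛ B → ∣ A ∣ ≡ j → ∣ B ∣ ≡ j → Disjoint A B →
               P (inside ∷ A) → P (inside ∷ B)
      closed A B i∉A i∉B _ ∣B∣≡j d pA
        with star-full (Shift? P? i) (shift-uniform i P-uniform) (trans (count-shift i P?) eq) centre
               (outside ∷ B ∪ᵢ i) (trans (∣A∪i∣ B i i∉B) (cong suc ∣B∣≡j) , there (i∈A∪i B i))
      ... | inj₂ (_ , pB) = subst (P ∘ (inside ∷_)) (A∪i∖i B i i∉B) pB
      ... | inj₁ pB∪i = contradiction (Disjoint-outʳ disj) (P-intersecting _ _ pA pB∪i)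
        where
        disj : Disjoint A (B ∪ᵢ i)
        disj x x∈A x∈ with x∈A∪i⁻ B i x∈
        ... | inj₁ refl = i∉A x∈A
        ... | inj₂ x∈B  = d x x∈A x∈B

      outside∉P : ∀ A → ¬ P (outside ∷ A)
      outside∉P A pA with centre (outside ∷ A) (inj₁ pA)
      -- Connectivity puts `inside ∷ A ∖ᵢ i` into `P`. Since its replacement `outside ∷ A` is
      -- present too, the shift would keep it, although it avoids the centre.
      ... | there i∈A with centre (inside ∷ A ∖ᵢ i)
              ( kneser-connected i j 2+2j≤n closed A₀ (A ∖ᵢ i) i∉A₀ (i∉A∖i A i) ∣A₀∣≡j
                  (suc-injective (trans (∣A∖i∣ A i i∈A) (P-uniform _ pA))) pA₀
              , inj₂ (subst (P ∘ (outside ∷_)) (sym (A∖i∪i A i i∈A)) pA))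
      ...   | there i∈A∖i = i∉A∖i A i i∈A∖i

  unshift-centre : ∃ (Centre (Shift P i)) → ∃ (Centre P)
  -- A full star at `zero` cannot arise: for `A` avoiding `i`, the set `inside ∷ A` survives only if
  -- `outside ∷ A ∪ᵢ i` is a member as well, and that one lacks `zero`.
  unshift-centre (zero , centre)
    with ∃-disjoint ⁅ i ⁆ j (≤-trans (≤-reflexive (cong (_+ j) (∣⁅x⁆∣≡1 i))) (≤-trans (+-monoˡ-≤ j (s≤s (z≤n {suc j}))) 2+2j≤n))
  ... | A , d , ∣A∣≡j with star-full (Shift? P? i) (shift-uniform i P-uniform) (trans (count-shift i P?) eq) centre
                             (inside ∷ A) (cong suc ∣A∣≡j , here)
  ...   | _ , inj₁ i∈A = contradiction i∈A (d i (x∈⁅x⁆ i))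
  ...   | _ , inj₂ q with centre (outside ∷ A ∪ᵢ i) (inj₁ q)
  ...     | ()
  unshift-centre (suc c , centre) with c ≟ᶠ i
  ... | yes refl = unshift-centre-i centre
  -- A member that the shift may have moved reappears with `i` in place of `zero`; as `c` differs
  -- from `i`, it was in the original set.
  ... | no c≢i   = suc c , λ
    { (outside ∷ A) pA → centre (outside ∷ A) (inj₁ pA)
    ; (inside ∷ A) pA → case i ∈? A of λ
        { (yes i∈A) → there (drop-there (centre (inside ∷ A) (pA , inj₁ i∈A)))
        ; (no i∉A)  → there ([ (λ c≡i → contradiction c≡i c≢i) , id ]′ (x∈A∪i⁻ A i (drop-there
            (centre (outside ∷ A ∪ᵢ i) (inj₂ (i∈A∪i A i , subst (P ∘ (inside ∷_)) (sym (A∪i∖i A i i∉A)) pA)))))) } }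

-- Links of shifted families, and families of singletons

∣p∪q∣≤∣p∣+∣q∣ : ∀ (A B : Subset n) → ∣ A ∪ B ∣ ≤ ∣ A ∣ + ∣ B ∣
∣p∪q∣≤∣p∣+∣q∣ []            []            = z≤n
∣p∪q∣≤∣p∣+∣q∣ (inside  ∷ A) (inside  ∷ B) = s≤s (≤-trans (∣p∪q∣≤∣p∣+∣q∣ A B) (+-monoʳ-≤ ∣ A ∣ (n≤1+n _)))
∣p∪q∣≤∣p∣+∣q∣ (inside  ∷ A) (outside ∷ B) = s≤s (∣p∪q∣≤∣p∣+∣q∣ A B)
∣p∪q∣≤∣p∣+∣q∣ (outside ∷ A) (inside  ∷ B) = ≤-trans (s≤s (∣p∪q∣≤∣p∣+∣q∣ A B)) (≤-reflexive (sym (+-suc _ _)))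
∣p∪q∣≤∣p∣+∣q∣ (outside ∷ A) (outside ∷ B) = ∣p∪q∣≤∣p∣+∣q∣ A B

-- Two disjoint link members cover at most `j + j` points, so some `x` lies outside both. Replacing
-- `zero` by `x` in one of the two sets gives disjoint members of `P`.
link-intersecting : {P : Pred (Subset (suc n)) 0ℓ} {j : ℕ} → Uniform (suc j) P → Intersecting P → Shifted P →
  j + j < n → Intersecting (P ∘ (inside ∷_))
link-intersecting P-uniform P-intersecting shifted 2j<n A B pA pB d
  with ∃-∉ (A ∪ B) (≤-<-trans (∣p∪q∣≤∣p∣+∣q∣ A B) (≤-<-trans (≤-reflexive (cong₂ _+_
         (suc-injective (P-uniform _ pA)) (suc-injective (P-uniform _ pB)))) 2j<n))
... | x , x∉A∪B = P-intersecting _ _ (shifted x A pA (x∉A∪B ∘ x∈p∪q⁺ ∘ inj₁)) pB (Disjoint-outˡ disj)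
  where
  disj : Disjoint (A ∪ᵢ x) B
  disj y y∈A∪x y∈B with x∈A∪i⁻ A x y∈A∪x
  ... | inj₁ refl = x∉A∪B (x∈p∪q⁺ (inj₂ y∈B))
  ... | inj₂ y∈A  = d y y∈A y∈B

∣A∣≡1⇒singleton : ∀ (A : Subset n) → ∣ A ∣ ≡ 1 → ∃ λ c → c ∈ₛ A × (∀ {x} → x ∈ₛ A → x ≡ c)
∣A∣≡1⇒singleton {n} A ∣A∣≡1 with nonempty? A
... | yes (c , c∈A) = c , c∈A , λ {x} x∈A → unique x x∈A
  where
  unique : ∀ x → x ∈ₛ A → x ≡ c
  unique x x∈A with x ≟ᶠ c
  ... | yes x≡c = x≡c
  ... | no x≢c  = contradiction (trans (cong suc (∣A∖i∣ (A ∖ᵢ c) x x∈A∖c)) (trans (∣A∖i∣ A c c∈A) ∣A∣≡1)) λ ()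
    where
    x∈A∖c : x ∈ₛ A ∖ᵢ c
    x∈A∖c with x∈A∪i⁻ (A ∖ᵢ c) c (subst (x ∈ₛ_) (sym (A∖i∪i A c c∈A)) x∈A)
    ... | inj₁ x≡c = contradiction x≡c x≢c
    ... | inj₂ x∈  = x∈
... | no empty = contradiction (trans (sym ∣A∣≡1) (trans (cong ∣_∣ (Empty-unique empty)) (∣⊥∣≡0 n))) λ ()

-- Intersecting singletons coincide. This serves the case `k = 1`, where the link of `zero` consists
-- of sets of size 0 and supplies no centre.
singletons-centre : {P : Pred (Subset n) 0ℓ} (P? : Decidable P) → Uniform 1 P → Intersecting P →
  count P? ≢ 0 → ∃ (Centre P)
singletons-centre P? P-uniform P-intersecting ∣P∣≢0 with anySubset? P?
... | no ¬e = contradiction (count≡0 P? λ A pA → ¬e (A , pA)) ∣P∣≢0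
... | yes (A , pA) with ∣A∣≡1⇒singleton A (P-uniform A pA)
...   | c , c∈A , unique = c , λ B pB → case c ∈? B of λ
  { (yes c∈B) → c∈B
  ; (no c∉B)  → contradiction (λ x x∈A x∈B → c∉B (subst (_∈ₛ B) (unique x∈A) x∈B)) (P-intersecting A B pA pB) }

-- The Erdős–Ko–Rado theorem

-- The ground set has `suc n` points so that a star has size `starSize n k`. The equality clause
-- asks only for a centre: by `star-full`, a tight family with a centre is the whole star.
EKR : ℕ → ℕ → {P : Pred (Subset (suc n)) 0ℓ} → Decidable P → Set
EKR n k {P} P? = Uniform k P → Intersecting P →
  count P? ≤ starSize n k × (k + k < suc n → count P? ≡ starSize n k → ∃ (Centre P))

-- The empty set is disjoint from itself, so an intersecting family of such sets has no members.
ekr-zero : {P : Pred (Subset (suc n)) 0ℓ} (P? : Decidable P) → EKR n 0 P?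
ekr-zero P? P-uniform P-intersecting = ≤-reflexive (count≡0 P? P-empty) , λ _ _ → zero , λ A pA → contradiction pA (P-empty A)
  where
  P-empty : ∀ A → ¬ _
  P-empty A pA = P-intersecting A A pA pA λ x x∈A _ → ∣A∣≡0⇒∉ A (P-uniform A pA) x∈A

-- Taking `P` against itself in `cross-bound` gives twice the count, and the middle binomial is
-- twice `n C j` by Pascal's rule and symmetry. The equality clause is vacuous here.
ekr-half : ∀ j → suc j + suc j ≡ suc n → {P : Pred (Subset (suc n)) 0ℓ} (P? : Decidable P) → EKR n (suc j) P?
ekr-half {n} j eq P? P-uniform P-intersecting = bound , λ 2k<n _ → contradiction eq (<⇒≢ 2k<n)
  where
  open ≤-Reasoning
  n≡ : n ≡ j + suc j
  n≡ = suc-injective (sym eq)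
  n∸j≡ : n ∸ j ≡ suc j
  n∸j≡ = trans (cong (_∸ j) n≡) (m+n∸m≡n j (suc j))
  bound : count P? ≤ n C j
  bound = *-cancelˡ-≤ 2 (begin
    2 * count P?            ≡⟨ cong (count P? +_) (+-identityʳ _) ⟩
    count P? + count P?     ≤⟨ cross-bound P? P? (trans (sym eq) (sym (+-identityʳ _))) P-uniform P-uniform P-intersecting ≤-refl ⟩
    suc n C suc j           ≡⟨ nCk+nC[k+1]≡[n+1]C[k+1] n j ⟨
    n C j + n C suc j       ≡⟨ cong (λ l → n C j + n C l) n∸j≡ ⟨
    n C j + n C (n ∸ j)     ≡⟨ cong (n C j +_) (nCk≡nC[n∸k] (≤-trans (m≤m+n j (suc j)) (≤-reflexive (sym n≡)))) ⟨
    n C j + n C j           ≡⟨ cong (n C j +_) (+-identityʳ _) ⟨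
    2 * (n C j)             ∎)

+-tightˡ : ∀ {a b c d} → a ≤ b → c ≤ d → a + c ≡ b + d → a ≡ b
+-tightˡ {a} {b} a≤b c≤d eq with a <? b
... | yes a<b = contradiction eq (<⇒≢ (+-mono-<-≤ a<b c≤d))
... | no a≮b  = ≤-antisym a≤b (≮⇒≥ a≮b)

+-tightʳ : ∀ {a b c d} → a ≤ b → c ≤ d → a + c ≡ b + d → c ≡ d
+-tightʳ {a} {b} {c} {d} a≤b c≤d eq = +-tightˡ c≤d a≤b (trans (+-comm c a) (trans eq (+-comm b d)))

2k≤n⇒2[k-1]<n : ∀ {j n} → suc j + suc j ≤ n → j + j < n
2k≤n⇒2[k-1]<n {j} p = ≤-trans (+-monoʳ-≤ (suc j) (n≤1+n j)) p

-- The bounds for link and deletion add up by Pascal's rule. In the equality case the link is itself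
-- tight, so for `j > 0` it is a full star about some `c`, and a deletion member avoiding `c` would
-- miss one of its sets.
ekr-shifted : ∀ j → suc j + suc j ≤ suc n →
  (∀ {P : Pred (Subset (suc n)) 0ℓ} (P? : Decidable P) → EKR n j P?) →
  (∀ {P : Pred (Subset (suc n)) 0ℓ} (P? : Decidable P) → EKR n (suc j) P?) →
  {P : Pred (Subset (suc (suc n))) 0ℓ} (P? : Decidable P) → Shifted P → EKR (suc n) (suc j) P?
ekr-shifted {n} j 2k≤n ekr-link ekr-deletion {P} P? shifted P-uniform P-intersecting =
  ≤-trans (+-mono-≤ (proj₁ link) (proj₁ deletion)) (≤-reflexive (starSize-suc n j)) , centre j refl
  where
  link-uniform : Uniform j (P ∘ (inside ∷_))
  link-uniform A pA = suc-injective (P-uniform _ pA)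
  2j<n : j + j < suc n
  2j<n = 2k≤n⇒2[k-1]<n 2k≤n
  link = ekr-link (λ A → P? (inside ∷ A)) link-uniform
           (link-intersecting P-uniform P-intersecting shifted 2j<n)
  deletion = ekr-deletion (λ A → P? (outside ∷ A)) (λ A → P-uniform _)
               (λ A B pA pB d → P-intersecting _ _ pA pB (Disjoint-outˡ d))
  -- `j` is passed again as `l`, so that splitting on it leaves `link` and `deletion` in place.
  centre : ∀ l → l ≡ j → suc j + suc j < suc (suc n) → count P? ≡ suc n C j → ∃ (Centre P)
  -- The assumed count is `suc n C 0`, that is 1, so the family is not empty.
  centre zero    refl _ eq = singletons-centre P? P-uniform P-intersecting λ e → contradiction (trans (sym eq) e) λ ()
  centre (suc l) refl _ eq
    with link-tight ← +-tightˡ (proj₁ link) (proj₁ deletion) (trans eq (sym (starSize-suc n j)))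
    with proj₂ link 2j<n link-tight
  ... | c , c-centre = suc c , λ
    { (inside  ∷ A) pA → there (c-centre A pA)
    ; (outside ∷ A) pA → case c ∈? A of λ { (yes c∈A) → there c∈A ; (no c∉A) → ⊥-elim (avoids A pA c∉A) } }
    where
    avoids : ∀ A → P (outside ∷ A) → c ∉ₛ A → ⊥
    -- Here `l` is one less than `j`: adding `c` to the `l`-set `D` gives a set of the star that
    -- makes up the link, and it misses `A`.
    avoids A pA c∉A with ∃-disjoint (A ∪ᵢ c) l
      (≤-trans (≤-reflexive (cong (_+ l) (trans (∣A∪i∣ A c c∉A) (cong suc (P-uniform _ pA)))))
                                               (≤-trans (s≤s (s≤s (≤-trans (≤-reflexive (sym (+-suc l l))) (+-monoʳ-≤ l (n≤1+n (suc l)))))) 2k≤n))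
    ... | D , d , ∣D∣≡l = P-intersecting _ _ (star-full (λ A → P? (inside ∷ A)) link-uniform link-tight c-centre
            (D ∪ᵢ c) (trans (∣A∪i∣ D c (d c (i∈A∪i A c))) (cong suc ∣D∣≡l) , i∈A∪i D c)) pA (Disjoint-outʳ disj)
      where
      disj : Disjoint (D ∪ᵢ c) A
      disj x x∈D∪c x∈A with x∈A∪i⁻ D c x∈D∪c
      ... | inj₁ refl = c∉A x∈A
      ... | inj₂ x∈D  = d x (A⊆A∪i c x∈A) x∈D

-- Outside the half case, `k + k` still fits after one point is removed, so link and deletion fall
-- under the induction hypothesis. A shift keeps the count, and its centre is carried back by
-- `unshift-centre`.
erdős-ko-rado : ∀ n k → k + k ≤ suc n → {P : Pred (Subset (suc n)) 0ℓ} (P? : Decidable P) → EKR n k P?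
erdős-ko-rado n       zero    _    P? = ekr-zero P?
erdős-ko-rado zero    (suc j) (s≤s p) P? = contradiction (≤-trans (≤-reflexive (sym (+-suc j j))) p) λ ()
erdős-ko-rado (suc n) (suc j) 2k≤n P? with suc j + suc j ≟ suc (suc n)
... | yes eq = ekr-half j eq P?
... | no neq = shift-induction (EKR (suc n) (suc j))
  (ekr-shifted j 2k≤n′
     (erdős-ko-rado n j (<⇒≤ (2k≤n⇒2[k-1]<n 2k≤n′)))
     (erdős-ko-rado n (suc j) 2k≤n′))
  unshift P?
  where
  2k≤n′ : suc j + suc j ≤ suc n
  2k≤n′ = s≤s⁻¹ (≤∧≢⇒< 2k≤n neq)
  unshift : ∀ {P : Pred (Subset (suc (suc n))) 0ℓ} (P? : Decidable P) i → EKR (suc n) (suc j) (Shift? P? i) → EKR (suc n) (suc j) P?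
  unshift P? i ekr-shift P-uniform P-intersecting
    with ekr-shift (shift-uniform i P-uniform) (shift-intersecting i P-intersecting)
  ... | bound , centre = subst (_≤ suc n C j) (count-shift i P?) bound
      , λ 2k<n eq → unshift-centre P? P-uniform P-intersecting i
          (≤-trans (≤-reflexive (cong suc (sym (+-suc j j)))) 2k≤n′) eq
          (centre 2k<n (trans (count-shift i P?) eq))

-- Levels of a family

-- The form to which `sumFromTo` unfolds.
Σ< : ℕ → (ℕ → ℕ) → ℕ
Σ< q f = sum (applyUpTo f q)

Σ<-cong : ∀ q {f g : ℕ → ℕ} → (∀ t → t < q → f t ≡ g t) → Σ< q f ≡ Σ< q g
Σ<-cong zero    f≗g = refl
Σ<-cong (suc q) f≗g = cong₂ _+_ (f≗g 0 z<s) (Σ<-cong q λ t t<q → f≗g (suc t) (s<s t<q))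

Σ<-zero : ∀ q {f : ℕ → ℕ} → (∀ t → t < q → f t ≡ 0) → Σ< q f ≡ 0
Σ<-zero zero    f≡0 = refl
Σ<-zero (suc q) f≡0 = cong₂ _+_ (f≡0 0 z<s) (Σ<-zero q λ t t<q → f≡0 (suc t) (s<s t<q))

-- The terms below k are listed downwards, so that in both sums the index grows
-- with the distance from the cut.
Σ<-split : ∀ k m (f : ℕ → ℕ) → Σ< (k + m) f ≡ Σ< k (λ t → f (k ∸ suc t)) + Σ< m (λ t → f (k + t))
Σ<-split zero    m f = refl
Σ<-split (suc k) m f = begin
  Σ< (suc k + m) f
    ≡⟨ cong (λ l → Σ< l f) (+-suc k m) ⟨
  Σ< (k + suc m) f
    ≡⟨ Σ<-split k (suc m) f ⟩
  Σ< k (λ t → f (k ∸ suc t)) + (f (k + 0) + Σ< m (λ t → f (k + suc t)))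
    ≡⟨ cong₂ (λ a b → Σ< k (λ t → f (k ∸ suc t)) + (f a + b)) (+-identityʳ k) (Σ<-cong m λ t _ → cong f (+-suc k t)) ⟩
  Σ< k (λ t → f (k ∸ suc t)) + (f k + Σ< m (λ t → f (suc k + t)))
    ≡⟨ rotate (Σ< k (λ t → f (k ∸ suc t))) (f k) _ ⟩
  f k + Σ< k (λ t → f (k ∸ suc t)) + Σ< m (λ t → f (suc k + t)) ∎
  where
  open ≡-Reasoning
  rotate : ∀ a b c → a + (b + c) ≡ b + a + c
  rotate = solve-∀

-- Here `u` stands for the levels below the cut, `v` for those above and `c` for the binomials. The
-- first `p` upper levels absorb their mirror images; the others obey the trivial bound.
Σ<-pair-≤ : ∀ p q {u v c : ℕ → ℕ} → p ≤ q → (∀ t → t < p → u t + v t ≤ c t) → (∀ t → v t ≤ c t) →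
            Σ< p u + Σ< q v ≤ Σ< q c
Σ<-pair-≤ zero    zero    _     _    _   = z≤n
Σ<-pair-≤ zero    (suc q) {u} _     _    v≤c = +-mono-≤ (v≤c 0) (Σ<-pair-≤ zero q {u} z≤n (λ _ ()) (v≤c ∘ suc))
Σ<-pair-≤ (suc p) (suc q) {u} p≤q uv≤c v≤c = ≤-trans
  (≤-reflexive (interchange (u 0) _ _ _))
  (+-mono-≤ (uv≤c 0 z<s) (Σ<-pair-≤ p q (s≤s⁻¹ p≤q) (λ t t<p → uv≤c (suc t) (s<s t<p)) (v≤c ∘ suc)))

-- Equality of the sums makes every termwise bound tight. A tight pair has an empty lower level by
-- assumption, which leaves its upper level full.
Σ<-pair-≡ : ∀ p q {u v c : ℕ → ℕ} → p ≤ q → (∀ t → t < p → u t + v t ≤ c t) → (∀ t → v t ≤ c t) →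
            (∀ t → t < p → u t + v t ≡ c t → u t ≡ 0) → Σ< p u + Σ< q v ≡ Σ< q c →
            (∀ t → t < p → u t ≡ 0) × (∀ t → t < q → v t ≡ c t)
Σ<-pair-≡ zero    zero    _     _    _   _      _  = (λ _ ()) , (λ _ ())
Σ<-pair-≡ zero    (suc q) {u} _     _    v≤c strict eq = (λ _ ()) , λ
  { zero    _   → +-tightˡ (v≤c 0) rest eq
  ; (suc t) t<q → proj₂ (Σ<-pair-≡ zero q {u} z≤n (λ _ ()) (v≤c ∘ suc) (λ _ ()) (+-tightʳ (v≤c 0) rest eq)) t (s<s⁻¹ t<q) }
  where rest = Σ<-pair-≤ zero q {u} z≤n (λ _ ()) (v≤c ∘ suc)
Σ<-pair-≡ (suc p) (suc q) {u} {v} {c} p≤q uv≤c v≤c strict eq =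
  (λ { zero _ → u0≡0 ; (suc t) t<p → proj₁ ih t (s<s⁻¹ t<p) }) ,
  (λ { zero _ → trans (cong (_+ v 0) (sym u0≡0)) uv≡c ; (suc t) t<q → proj₂ ih t (s<s⁻¹ t<q) })
  where
  uv≤c′ : ∀ t → t < p → u (suc t) + v (suc t) ≤ c (suc t)
  uv≤c′ t t<p = uv≤c (suc t) (s<s t<p)
  rest = Σ<-pair-≤ p q (s≤s⁻¹ p≤q) uv≤c′ (v≤c ∘ suc)
  eq′ = trans (sym (interchange (u 0) _ _ _)) eq
  uv≡c : u 0 + v 0 ≡ c 0
  uv≡c = +-tightˡ (uv≤c 0 z<s) rest eq′
  u0≡0 = strict 0 z<s uv≡c
  ih = Σ<-pair-≡ p q (s≤s⁻¹ p≤q) uv≤c′ (v≤c ∘ suc) (λ t t<p → strict (suc t) (s<s t<p))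
         (+-tightʳ (uv≤c 0 z<s) rest eq′)

Σₛ-Σ< : ∀ q (f : Subset n → ℕ → ℕ) → Σₛ (λ A → Σ< q (f A)) ≡ Σ< q (λ i → Σₛ (λ A → f A i))
Σₛ-Σ< {n} zero    f = Σₛ-zero {n} λ _ → refl
Σₛ-Σ< (suc q) f = trans (Σₛ-+ (λ A → f A 0) _) (cong (Σₛ (λ A → f A 0) +_) (Σₛ-Σ< q (λ A → f A ∘ suc)))

Σ<-𝟙 : ∀ {X : Set} (X? : Dec X) l q → l < q → Σ< q (λ i → 𝟙 (X? ×-dec l ≟ i)) ≡ 𝟙 X?
Σ<-𝟙 X? zero    (suc q) _   = trans
  (cong₂ _+_ (𝟙-cong (X? ×-dec 0 ≟ 0) X? proj₁ (_, refl)) (Σ<-zero q λ t _ → 𝟙-no (X? ×-dec 0 ≟ suc t) λ ()))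
  (+-identityʳ _)
-- `𝟙` inspects only `does`, so the indicators for `suc l ≟ suc i` and `l ≟ i` agree by computation.
Σ<-𝟙 X? (suc l) (suc q) l<q = cong₂ _+_ (𝟙-no (X? ×-dec suc l ≟ 0) λ ()) (Σ<-𝟙 X? l q (s<s⁻¹ l<q))

-- Level sizes

Level : Pred (Subset n) 0ℓ → ℕ → Pred (Subset n) 0ℓ
Level P i A = P A × ∣ A ∣ ≡ i

module _ {P : Pred (Subset n) 0ℓ} (P? : Decidable P) where

  Level? : ∀ i → Decidable (Level P i)
  Level? i A = P? A ×-dec ∣ A ∣ ≟ i

  profile : ℕ → ℕ
  profile i = count (Level? i)

  profile≤ : ∀ i → profile i ≤ n C i
  profile≤ i = ≤-trans (count-mono (Level? i) (λ A → ∣ A ∣ ≟ i) (λ _ → proj₂)) (≤-reflexive (count-size n i))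

  profile-full : ∀ i → (∀ A → ∣ A ∣ ≡ i → P A) → profile i ≡ n C i
  profile-full i full = trans (count-cong (Level? i) (λ A → ∣ A ∣ ≟ i) (λ _ → proj₂) (λ A e → full A e , e)) (count-size n i)

  profile-full⁻¹ : ∀ A → profile ∣ A ∣ ≡ n C ∣ A ∣ → P A
  profile-full⁻¹ A eq = proj₁ (count-full (Level? ∣ A ∣) (λ B → ∣ B ∣ ≟ ∣ A ∣) (λ _ → proj₂) (trans eq (sym (count-size n ∣ A ∣))) A refl)

  profile-empty : ∀ i → (∀ A → ∣ A ∣ ≡ i → ¬ P A) → profile i ≡ 0
  profile-empty i empty = count≡0 (Level? i) λ A (pA , e) → empty A e pA

  profile-empty⁻¹ : ∀ A → profile ∣ A ∣ ≡ 0 → ¬ P A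
  profile-empty⁻¹ A eq pA = count≡0⁻¹ (Level? ∣ A ∣) eq A (pA , refl)

  count-profile : count P? ≡ Σ< (suc n) profile
  count-profile = trans (Σₛ-cong λ A → sym (Σ<-𝟙 (P? A) ∣ A ∣ (suc n) (s≤s (∣p∣≤n A))))
                        (Σₛ-Σ< (suc n) (λ A i → 𝟙 (P? A ×-dec ∣ A ∣ ≟ i)))

  count-split : ∀ k → k ≤ suc n →
    count P? ≡ Σ< k (λ t → profile (k ∸ suc t)) + Σ< (suc n ∸ k) (λ t → profile (k + t))
  count-split k k≤ = trans count-profile (trans (cong (λ l → Σ< l profile) (sym (m+[n∸m]≡n k≤))) (Σ<-split k (suc n ∸ k) profile))

  -- Level `k` is set apart, as it is its own mirror image when `s` is `k + k`. The index
  -- `k + 1 + t` matches the sum in the theorem.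
  count-split₃ : ∀ k → k ≤ n →
    count P? ≡ profile k + (Σ< k (λ t → profile (k ∸ suc t)) + Σ< (n ∸ k) (λ t → profile (k + 1 + t)))
  count-split₃ k k≤n = begin
    count P?
      ≡⟨ count-split k (m≤n⇒m≤1+n k≤n) ⟩
    Σ< k (λ t → profile (k ∸ suc t)) + Σ< (suc n ∸ k) (λ t → profile (k + t))
      ≡⟨ cong (λ l → Σ< k (λ t → profile (k ∸ suc t)) + Σ< l (λ t → profile (k + t))) (+-∸-assoc 1 k≤n) ⟩
    Σ< k (λ t → profile (k ∸ suc t)) + (profile (k + 0) + Σ< (n ∸ k) (λ t → profile (k + suc t)))
      ≡⟨ cong₂ (λ a b → Σ< k (λ t → profile (k ∸ suc t)) + (profile a + b)) (+-identityʳ k)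
           (Σ<-cong (n ∸ k) λ t _ → cong profile (sym (+-assoc k 1 t))) ⟩
    Σ< k (λ t → profile (k ∸ suc t)) + (profile k + Σ< (n ∸ k) (λ t → profile (k + 1 + t)))
      ≡⟨ rotate (Σ< k (λ t → profile (k ∸ suc t))) (profile k) _ ⟩
    profile k + (Σ< k (λ t → profile (k ∸ suc t)) + Σ< (n ∸ k) (λ t → profile (k + 1 + t))) ∎
    where
    open ≡-Reasoning
    rotate : ∀ a b c → a + (b + c) ≡ b + (a + c)
    rotate = solve-∀

-- Families given as lists

_∈?ₗ_ : ∀ (A : Subset n) (F : List (Subset n)) → Dec (A ∈ F)
_∈?ₗ_ = DecMembership._∈?_ (Vec.≡-dec Bool._≟_)

count-≡ : ∀ (B : Subset n) → count (λ A → Vec.≡-dec Bool._≟_ A B) ≡ 1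
count-≡ []            = refl
count-≡ (inside  ∷ B) = cong₂ _+_
  (trans (count-cong (λ A → Vec.≡-dec Bool._≟_ (inside ∷ A) (inside ∷ B)) (λ A → Vec.≡-dec Bool._≟_ A B)
           (λ _ → Vec.∷-injectiveʳ) (λ _ → cong (inside ∷_))) (count-≡ B))
  (count≡0 (λ A → Vec.≡-dec Bool._≟_ (outside ∷ A) (inside ∷ B)) λ _ ())
count-≡ (outside ∷ B) = cong₂ _+_
  (count≡0 (λ A → Vec.≡-dec Bool._≟_ (inside ∷ A) (outside ∷ B)) λ _ ())
  (trans (count-cong (λ A → Vec.≡-dec Bool._≟_ (outside ∷ A) (outside ∷ B)) (λ A → Vec.≡-dec Bool._≟_ A B)
           (λ _ → Vec.∷-injectiveʳ) (λ _ → cong (outside ∷_))) (count-≡ B))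

𝟙-⊎ : ∀ {X Y Z : Set} (X? : Dec X) (Y? : Dec Y) (Z? : Dec Z) →
      (X → Y ⊎ Z) → (Y ⊎ Z → X) → (Y → ¬ Z) → 𝟙 X? ≡ 𝟙 Y? + 𝟙 Z?
𝟙-⊎ X? (yes y) Z? _   Y⊎Z⇒X Y⇒¬Z = trans (𝟙-yes X? (Y⊎Z⇒X (inj₁ y))) (cong suc (sym (𝟙-no Z? (Y⇒¬Z y))))
𝟙-⊎ X? (no ¬y) Z? X⇒Y⊎Z Y⊎Z⇒X _  =
  𝟙-cong X? Z? (λ x → [ (λ y → contradiction y ¬y) , id ]′ (X⇒Y⊎Z x)) (Y⊎Z⇒X ∘ inj₂)

-- Without repetitions, being the head and lying in the tail exclude each other, so each entry
-- raises the count by one.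
length≡count : ∀ {F : List (Subset n)} → Unique F → length F ≡ count (_∈?ₗ F)
length≡count {n} {[]} [] = sym (count≡0 (λ (A : Subset n) → A ∈?ₗ []) λ _ ())
length≡count {F = B ∷ F} (B∉F ∷ F-unique) = sym (begin
  count (_∈?ₗ (B ∷ F))
    ≡⟨ Σₛ-cong pointwise ⟩
  Σₛ (λ A → 𝟙 (Vec.≡-dec Bool._≟_ A B) + 𝟙 (A ∈?ₗ F))
    ≡⟨ Σₛ-+ (λ A → 𝟙 (Vec.≡-dec Bool._≟_ A B)) _ ⟩
  count (λ A → Vec.≡-dec Bool._≟_ A B) + count (_∈?ₗ F)
    ≡⟨ cong₂ _+_ (count-≡ B) (sym (length≡count F-unique)) ⟩
  suc (length F) ∎)
  where
  open ≡-Reasoning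
  pointwise : ∀ A → 𝟙 (A ∈?ₗ (B ∷ F)) ≡ 𝟙 (Vec.≡-dec Bool._≟_ A B) + 𝟙 (A ∈?ₗ F)
  pointwise A = 𝟙-⊎ (A ∈?ₗ (B ∷ F)) (Vec.≡-dec Bool._≟_ A B) (A ∈?ₗ F)
    (λ { (here A≡B) → inj₁ A≡B ; (there A∈F) → inj₂ A∈F }) [ here , there ]′
    (λ { refl A∈F → All.lookup B∉F A∈F refl })

-- Conditionally intersecting families

module _ {P : Pred (Subset n) 0ℓ} (P? : Decidable P) {s : ℕ}
  (P-meets : ∀ A B → P A → P B → ∣ A ∣ + ∣ B ∣ ≤ s → ¬ Disjoint A B) where

  level-cross : ∀ {i j} → i + j ≡ s → CrossIntersecting (Level P i) (Level P j)
  level-cross i+j≡s A B (pA , refl) (pB , refl) = P-meets A B pA pB (≤-reflexive i+j≡s)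

  profile-pair-≤ : s ≤ n → ∀ {i j} → i + j ≡ s → i ≤ j → profile P? i + profile P? j ≤ n C j
  profile-pair-≤ s≤n {i} {j} i+j≡s = cross-bound (Level? P? i) (Level? P? j)
    (trans (sym (m+[n∸m]≡n s≤n)) (cong (_+ (n ∸ s)) (sym i+j≡s))) (λ _ → proj₂) (λ _ → proj₂) (level-cross i+j≡s)

  -- The strict inequality `s < n` provides the spare point that `cross-equality` requires.
  profile-pair-≡ : s < n → ∀ {i j} → i + j ≡ s → i < j → profile P? i + profile P? j ≡ n C j → profile P? i ≡ 0
  profile-pair-≡ s<n {i} {j} i+j≡s = cross-equality (Level? P? i) (Level? P? j)
    (trans (sym (m+[n∸m]≡n s<n)) (trans (sym (+-suc s _)) (cong (_+ suc (n ∸ suc s)) (sym i+j≡s))))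
    (λ _ → proj₂) (λ _ → proj₂) (level-cross i+j≡s)

module _ {P : Pred (Subset n) 0ℓ} (P? : Decidable P) (k : ℕ) where

  at-least-count : k ≤ suc n → P ≐ AtLeast n k → count P? ≡ ∑[ i ≔ k to n ] (n C i)
  at-least-count k≤ (P⇒ , ⇒P) = trans (count-split P? k k≤) (cong₂ _+_
    (Σ<-zero k λ t t<k → profile-empty P? (k ∸ suc t) λ A e pA →
      <⇒≱ (∸-monoʳ-< z<s t<k) (≤-trans (P⇒ pA) (≤-reflexive e)))
    (Σ<-cong (suc n ∸ k) λ t _ → profile-full P? (k + t) λ A e → ⇒P (≤-trans (m≤m+n k t) (≤-reflexive (sym e)))))

  -- The levels below `k` are listed downwards, so level `∣ A ∣` stands at position `k ∸ suc ∣ A ∣`.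
  profile-zeros : (∀ t → t < k → profile P? (k ∸ suc t) ≡ 0) → ∀ A → ∣ A ∣ < k → ¬ P A
  profile-zeros zeros A ∣A∣<k = profile-empty⁻¹ P? A (trans (cong (profile P?) (sym k∸t≡))
    (zeros (k ∸ suc ∣ A ∣) (∸-monoʳ-< z<s ∣A∣<k)))
    where
    k∸t≡ : k ∸ suc (k ∸ suc ∣ A ∣) ≡ ∣ A ∣
    k∸t≡ = trans (cong (k ∸_) (sym (+-∸-assoc 1 ∣A∣<k))) (m∸[m∸n]≡n (<⇒≤ ∣A∣<k))

  profile-fulls : ∀ l → (∀ t → t < suc n ∸ l → profile P? (l + t) ≡ n C (l + t)) → ∀ A → l ≤ ∣ A ∣ → P A
  profile-fulls l fulls A l≤∣A∣ = profile-full⁻¹ P? A (subst (λ i → profile P? i ≡ n C i) (m+[n∸m]≡n l≤∣A∣)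
    (fulls (∣ A ∣ ∸ l) (∸-monoˡ-< (s≤s (∣p∣≤n A)) l≤∣A∣)))

module _ {P : Pred (Subset n) 0ℓ} (P? : Decidable P) (j : ℕ) (s≤n : j + suc j ≤ n)
  (P-meets : ∀ A B → P A → P B → ∣ A ∣ + ∣ B ∣ ≤ j + suc j → ¬ Disjoint A B) where

  private
    -- There are at least as many levels above the cut as below it, so every lower level has a
    -- mirror image.
    k≤q : suc j ≤ suc n ∸ suc j
    k≤q = m+n≤o⇒m≤o∸n (suc j) (s≤s s≤n)
    k≤1+n : suc j ≤ suc n
    k≤1+n = ≤-trans (m≤m+n (suc j) (suc j)) (s≤s s≤n)
    -- With `k = suc j` the cut falls between the levels `j` and `suc j`, and no level is its own
    -- mirror image.
    mirror : ∀ t → t < suc j → (j ∸ t) + (suc j + t) ≡ j + suc j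
    mirror t (s≤s t≤j) = trans (regroup (j ∸ t) (suc j) t) (cong (_+ suc j) (m∸n+n≡m t≤j))
      where
      regroup : ∀ a b c → a + (b + c) ≡ (a + c) + b
      regroup = solve-∀
    below : ∀ t → j ∸ t < suc j + t
    below t = ≤-trans (s≤s (m∸n≤m j t)) (m≤m+n (suc j) t)
    pairs : ∀ t → t < suc j → profile P? (j ∸ t) + profile P? (suc j + t) ≤ n C (suc j + t)
    pairs t t≤j = profile-pair-≤ P? P-meets s≤n (mirror t t≤j) (<⇒≤ (below t))

  odd-bound : count P? ≤ ∑[ i ≔ suc j to n ] (n C i)
  odd-bound = ≤-trans (≤-reflexive (count-split P? (suc j) k≤1+n))
    (Σ<-pair-≤ (suc j) (suc n ∸ suc j) k≤q pairs (λ t → profile≤ P? (suc j + t)))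

  odd-equality : j + suc j < n → count P? ≡ ∑[ i ≔ suc j to n ] (n C i) → P ≐ AtLeast n (suc j)
  odd-equality s<n eq
    with zeros , fulls ← Σ<-pair-≡ (suc j) (suc n ∸ suc j) k≤q pairs (λ t → profile≤ P? (suc j + t))
           (λ t t≤j → profile-pair-≡ P? P-meets s<n (mirror t t≤j) (below t))
           (trans (sym (count-split P? (suc j) k≤1+n)) eq)
    = (λ {A} pA → ≮⇒≥ λ ∣A∣<k → profile-zeros P? (suc j) zeros A ∣A∣<k pA)
    , (λ {A} → profile-fulls P? (suc j) (suc j) fulls A)

StarAtAndLarger : Fin n → ℕ → Pred (Subset n) 0ℓ
StarAtAndLarger c k A = InStar c k A ⊎ k < ∣ A ∣

star-and-larger-count : {P : Pred (Subset (suc n)) 0ℓ} (P? : Decidable P) (c : Fin (suc n)) → k ≤ suc n →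
  P ≐ StarAtAndLarger c k → count P? ≡ starSize n k + ∑[ i ≔ k + 1 to suc n ] (suc n C i)
star-and-larger-count {n} {k} P? c k≤n (P⇒ , ⇒P) = trans (count-split₃ P? k k≤n) (cong₂ _+_
  (trans (count-cong (Level? P? k) (InStar? c k)
           (λ { A (pA , e) → [ id , (λ k<∣A∣ → contradiction (sym e) (<⇒≢ k<∣A∣)) ]′ (P⇒ pA) })
           (λ A (e , c∈A) → ⇒P (inj₁ (e , c∈A)) , e))
         (count-star c k))
  (trans (cong₂ _+_
    (Σ<-zero k λ t t<k → profile-empty P? (k ∸ suc t) λ A e pA →
      let ∣A∣<k = ≤-<-trans (≤-reflexive e) (∸-monoʳ-< z<s t<k) in
      [ (λ (e′ , _) → <⇒≢ ∣A∣<k e′) , <-asym ∣A∣<k ]′ (P⇒ pA))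
    (Σ<-cong (suc n ∸ k) λ t _ → profile-full P? (k + 1 + t) λ A e → ⇒P (inj₂
      (≤-trans (≤-trans (≤-reflexive (+-comm 1 k)) (m≤m+n (k + 1) t)) (≤-reflexive (sym e))))))
    (cong (λ l → Σ< (suc (suc n) ∸ l) (λ t → suc n C (k + 1 + t))) (+-comm 1 k))))

module _ {P : Pred (Subset (suc n)) 0ℓ} (P? : Decidable P) (k : ℕ) (2k≤n : k + k ≤ suc n)
  (P-meets : ∀ A B → P A → P B → ∣ A ∣ + ∣ B ∣ ≤ k + k → ¬ Disjoint A B) where

  private
    k≤q : k ≤ suc n ∸ k
    k≤q = m+n≤o⇒m≤o∸n k 2k≤n
    k≤n : k ≤ suc n
    k≤n = ≤-trans (m≤m+n k k) 2k≤n
    mirror : ∀ t → t < k → (k ∸ suc t) + (k + 1 + t) ≡ k + k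
    mirror t t<k = trans (regroup (k ∸ suc t) k t) (cong (_+ k) (m∸n+n≡m t<k))
      where
      regroup : ∀ a b c → a + (b + 1 + c) ≡ (a + (1 + c)) + b
      regroup = solve-∀
    below : ∀ t → k ∸ suc t < k + 1 + t
    below t = ≤-trans (s≤s (m∸n≤m k (suc t))) (≤-trans (≤-reflexive (+-comm 1 k)) (m≤m+n (k + 1) t))
    pairs : ∀ t → t < k → profile P? (k ∸ suc t) + profile P? (k + 1 + t) ≤ suc n C (k + 1 + t)
    pairs t t<k = profile-pair-≤ P? P-meets 2k≤n (mirror t t<k) (<⇒≤ (below t))
    outer : Σ< k (λ t → profile P? (k ∸ suc t)) + Σ< (suc n ∸ k) (λ t → profile P? (k + 1 + t))
          ≤ Σ< (suc n ∸ k) (λ t → suc n C (k + 1 + t))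
    outer = Σ<-pair-≤ k (suc n ∸ k) k≤q pairs (λ t → profile≤ P? (k + 1 + t))
    -- Pairing level `k` with itself in `level-cross` says that it is intersecting.
    middle = erdős-ko-rado n k 2k≤n (Level? P? k) (λ _ → proj₂) (level-cross P? P-meets refl)
    -- `suc (suc n) ∸ (k + 1)` does not compute, whereas with `suc k` it reduces to `suc n ∸ k`.
    target≡ : starSize n k + Σ< (suc n ∸ k) (λ t → suc n C (k + 1 + t))
            ≡ starSize n k + ∑[ i ≔ k + 1 to suc n ] (suc n C i)
    target≡ = cong (λ l → starSize n k + Σ< (suc (suc n) ∸ l) (λ t → suc n C (k + 1 + t))) (+-comm 1 k)

  even-bound : count P? ≤ starSize n k + ∑[ i ≔ k + 1 to suc n ] (suc n C i)
  even-bound = ≤-trans (≤-reflexive (count-split₃ P? k k≤n))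
    (≤-trans (+-mono-≤ (proj₁ middle) outer) (≤-reflexive target≡))

  -- Both parts of the bound must be tight: Erdős-Ko-Rado gives the centre of level `k`, and the
  -- pairing empties the levels below and fills those above.
  even-equality : k + k < suc n → count P? ≡ starSize n k + ∑[ i ≔ k + 1 to suc n ] (suc n C i) →
                  ∃ λ c → P ≐ StarAtAndLarger c k
  even-equality 2k<n eq
    with eq′ ← trans (sym (count-split₃ P? k k≤n)) (trans eq (sym target≡))
    with tight ← +-tightˡ (proj₁ middle) outer eq′
    with zeros , fulls ← Σ<-pair-≡ k (suc n ∸ k) k≤q pairs (λ t → profile≤ P? (k + 1 + t))
           (λ t t<k → profile-pair-≡ P? P-meets 2k<n (mirror t t<k) (below t))
           (+-tightʳ (proj₁ middle) outer eq′)
    with c , centre ← proj₂ middle 2k<n tight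
    = c , P⇒ , ⇒P
    where
    P⇒ : ∀ {A} → P A → StarAtAndLarger c k A
    P⇒ {A} pA with m≤n⇒m<n∨m≡n (≮⇒≥ λ ∣A∣<k → profile-zeros P? k zeros A ∣A∣<k pA)
    ... | inj₁ k<∣A∣ = inj₂ k<∣A∣
    ... | inj₂ k≡∣A∣ = inj₁ (sym k≡∣A∣ , centre A (pA , sym k≡∣A∣))
    ⇒P : ∀ {A} → StarAtAndLarger c k A → P A
    ⇒P {A} (inj₁ A∈star) = proj₁ (star-full (Level? P? k) (λ _ → proj₂) tight centre A A∈star)
    ⇒P {A} (inj₂ k<∣A∣)  = profile-fulls P? k (k + 1)
      (λ t t< → fulls t (subst (λ l → t < suc (suc n) ∸ l) (+-comm k 1) t<)) A (≤-trans (≤-reflexive (+-comm k 1)) k<∣A∣)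

-- Permutations of the ground set

open CMSum +-0-commutativeMonoid using () renaming (sum to ∑; sum-permute to ∑-permute)

-- Written as a sum over points, the size is seen to be invariant under reordering.
∣tabulate∣ : ∀ (f : Fin n → Bool) → ∣ tabulate f ∣ ≡ ∑ (λ x → if f x then 1 else 0)
∣tabulate∣ {zero}  f = refl
∣tabulate∣ {suc n} f with f zero
... | true  = cong suc (∣tabulate∣ (f ∘ suc))
... | false = ∣tabulate∣ (f ∘ suc)

module _ (σ : Permutation′ n) where

  ∣image∣ : ∀ A → ∣ image σ A ∣ ≡ ∣ A ∣
  ∣image∣ A = begin
    ∣ image σ A ∣
      ≡⟨ ∣tabulate∣ (λ x → lookup A (σ ⟨$⟩ˡ x)) ⟩
    ∑ (λ x → if lookup A (σ ⟨$⟩ˡ x) then 1 else 0)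
      ≡⟨ ∑-permute (λ x → if lookup A x then 1 else 0) (flip σ) ⟨
    ∑ (λ x → if lookup A x then 1 else 0)
      ≡⟨ ∣tabulate∣ (lookup A) ⟨
    ∣ tabulate (lookup A) ∣
      ≡⟨ cong ∣_∣ (Vec.tabulate∘lookup A) ⟩
    ∣ A ∣ ∎
    where open ≡-Reasoning

  image-flip : ∀ A → image σ (image (flip σ) A) ≡ A
  image-flip A = trans (Vec.tabulate-cong λ x → trans (Vec.lookup∘tabulate _ (σ ⟨$⟩ˡ x)) (cong (lookup A) (inverseʳ σ)))
                       (Vec.tabulate∘lookup A)

  ∈-image⁺ : ∀ {A x} → σ ⟨$⟩ˡ x ∈ₛ A → x ∈ₛ image σ A
  ∈-image⁺ {A} {x} x∈ = Vec.lookup⇒[]= x (image σ A) (trans (Vec.lookup∘tabulate _ x) (Vec.[]=⇒lookup x∈))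

image-injective : ∀ (σ : Permutation′ n) {A B} → image σ A ≡ image σ B → A ≡ B
image-injective σ {A} {B} eq =
  trans (sym (image-flip (flip σ) A)) (trans (cong (image (flip σ)) eq) (image-flip (flip σ) B))

-- Sizes are preserved, and an image contains `zero` exactly when the original contains its preimage
-- under `σ`, which is therefore the centre to start from.
map-image-≐ : ∀ (σ : Permutation′ (suc n)) {F : List (Subset (suc n))} →
  (_∈ F) ≐ StarAtAndLarger (σ ⟨$⟩ˡ zero) k → (_∈ map (image σ) F) ≐ StarAndLarger (suc n) k
map-image-≐ {k = k} σ {F} (F⇒ , ⇒F) = to , from
  where
  to : ∀ {A} → A ∈ map (image σ) F → StarAndLarger _ k A
  to A∈ with ∈-map⁻ (image σ) A∈
  ... | B , B∈F , refl with F⇒ B∈F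
  ...   | inj₁ (∣B∣≡k , c∈B) = inj₁ (trans (∣image∣ σ B) ∣B∣≡k , ∈-image⁺ σ c∈B)
  ...   | inj₂ k<∣B∣         = inj₂ (≤-trans k<∣B∣ (≤-reflexive (sym (∣image∣ σ B))))
  from : ∀ {A} → StarAndLarger _ k A → A ∈ map (image σ) F
  from {A} A∈ = subst (_∈ map (image σ) F) (image-flip σ A) (∈-map⁺ (image σ) (⇒F (pull A∈)))
    where
    pull : StarAndLarger _ k A → StarAtAndLarger (σ ⟨$⟩ˡ zero) k (image (flip σ) A)
    pull (inj₁ (∣A∣≡k , 0∈A)) = inj₁ (trans (∣image∣ (flip σ) A) ∣A∣≡k ,
                                       ∈-image⁺ (flip σ) (subst (_∈ₛ A) (sym (inverseʳ σ)) 0∈A))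
    pull (inj₂ k<∣A∣)         = inj₂ (≤-trans k<∣A∣ (≤-reflexive (sym (∣image∣ (flip σ) A))))

transpose-to-zero : ∀ (c : Fin (suc n)) → transpose zero c ⟨$⟩ˡ zero ≡ c
transpose-to-zero zero    = refl
transpose-to-zero (suc c) = refl

theorem23 : ∀ (n s k : ℕ) .{{_ : NonZero n}} .{{_ : NonZero s}} .{{_ : NonZero k}} →
    s ≤ n →
    (F : List (Subset n)) → Unique F →
    ConditionallyIntersecting₂ s F →
    (s ≡ 2 * k →
    length F ≤ ((n ∸ 1) C (k ∸ 1)) + (∑[ i ≔ k + 1 to n ] (n C i))
    × (s < n →
    (length F ≡ ((n ∸ 1) C (k ∸ 1)) + (∑[ i ≔ k + 1 to n ] (n C i)))
    ⇔ (∃ λ (σ : Permutation′ n) → (_∈ map (image σ) F) ≐ StarAndLarger n k)))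
    × (s ≡ 2 * k ∸ 1 →
    length F ≤ (∑[ i ≔ k to n ] (n C i))
    × (s < n →
    (length F ≡ (∑[ i ≔ k to n ] (n C i)))
    ⇔ ((_∈ F) ≐ AtLeast n k)))
theorem23 (suc n) s k@(suc j) s≤n F F-unique F-meets = even , odd
  where
  F-disjoint : ∀ A B → A ∈ F → B ∈ F → ∣ A ∣ + ∣ B ∣ ≤ s → ¬ Disjoint A B
  F-disjoint A B A∈F B∈F ≤s d =
    let x , x∈A∩B = F-meets A∈F B∈F (≤-trans (∣p∪q∣≤∣p∣+∣q∣ A B) ≤s)
        x∈A , x∈B = x∈p∩q⁻ A B x∈A∩B
    in d x x∈A x∈B

  ∣F∣ : length F ≡ count (_∈?ₗ F)
  ∣F∣ = length≡count F-unique

  even : s ≡ 2 * k → _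
  -- `2 * k` unfolds to `k + (k + 0)`. As `k` is `suc j`, `starSize n k` is by computation the
  -- binomial of the statement.
  even s≡2k with refl ← trans s≡2k (cong (k +_) (+-identityʳ k)) =
      ≤-trans (≤-reflexive ∣F∣) (even-bound (_∈?ₗ F) k s≤n F-disjoint)
    , λ s<n → mk⇔
        (λ eq → let c , F≐ = even-equality (_∈?ₗ F) k s≤n F-disjoint s<n (trans (sym ∣F∣) eq) in
          -- Any permutation carrying the centre to the first element would do; the transposition of
          -- the two is one.
          transpose zero c ,
          map-image-≐ (transpose zero c) (subst (λ c → (_∈ F) ≐ StarAtAndLarger c k) (sym (transpose-to-zero c)) F≐))
        (λ (σ , σF≐) → begin
          -- The image family has the same length as `F` and is already in standard form, so it is
          -- the one that is counted.
          length F                       ≡⟨ length-map (image σ) F ⟨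
          length (map (image σ) F)       ≡⟨ length≡count (map⁺ (image-injective σ) F-unique) ⟩
          count (_∈?ₗ map (image σ) F)   ≡⟨ star-and-larger-count (_∈?ₗ map (image σ) F) zero (≤-trans (m≤m+n k k) s≤n) σF≐ ⟩
          starSize n k + (∑[ i ≔ k + 1 to suc n ] (suc n C i)) ∎)
    where open ≡-Reasoning

  odd : s ≡ 2 * k ∸ 1 → _
  -- For `k = suc j` the truncated `2 * k ∸ 1` computes to `j + (suc j + 0)`.
  odd s≡2k-1 with refl ← trans s≡2k-1 (cong (j +_) (+-identityʳ k)) =
      ≤-trans (≤-reflexive ∣F∣) (odd-bound (_∈?ₗ F) j s≤n F-disjoint)
    , λ s<n → mk⇔
        (λ eq → odd-equality (_∈?ₗ F) j s≤n F-disjoint s<n (trans (sym ∣F∣) eq))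
        (λ F≐ → trans ∣F∣ (at-least-count (_∈?ₗ F) k (≤-trans (m≤m+n k k) (s≤s s≤n)) F≐))
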